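{- Let $r,n\ge 1$ be integers, $A=[r]=\{1,\dots,r\}$, and $s\in\{1,\dots,r\}$. Let $f:A^n\to[0,1]$ be an $s$-compressed fractional family with $|f|\le s^n$, and let $h=b^{(n,s)}_{k,\alpha}$ be a fractional Hamming ball on $A^n$ with $|h|=|f|$. Then $|\Delta f|\ge|\Delta h|$.
   Context: A fractional family on $A^n$ is any function $f:A^n\to[0,1]$; its weight is $|f|=\sum_{w\in A^n}f(w)$. Its deletion shadow is the fractional family $\Delta f$ on $A^{n-1}$ given by $(\Delta f)(x_1,\dots,x_{n-1})=\max_{y\in A,\ i\in[n]} f(x_1,\dots,x_{i-1},y,x_i,\dots,x_{n-1})$ (the maximum over all ways of inserting one letter $y$ at position $i$). For integers $k\ge 0$ and $\alpha\in[0,1]$, the fractional Hamming ball $b^{(n,s)}_{k,\alpha}:A^n\to[0,1]$ takes value $1$ on words of $[s]^n$ containing the symbol $s$ at most $k$ times, value $\alpha$ on words of $[s]^n$ containing the symbol $s$ exactly $k+1$ times, and $0$ on all other words of $A^n$. (For every weight in $[0,s^n]$ there is such a ball of that weight, and the ball as a function is determined by its weight, since e.g. $b_{k-1,1}=b_{k,0}$.) For $\ell\in A$, a fractional family $f$ on $A^n$ is $\ell$-compressed if for all $x_1,\dots,x_n,y\in A$ and $i\in[n]$ with $y<x_i$ and $\ell\le x_i$, $f(x_1,\dots,x_n)>0$ implies $f(x_1,\dots,x_{i-1},y,x_{i+1},\dots,x_n)=1$. -}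

module Defs where

open import Algebra.Bundles using (CommutativeMonoid)
open import Data.Bool using (if_then_else_)
open import Data.Fin using (Fin; toℕ)
import Data.Fin as Fin
import Data.Fin.Properties as Fin
open import Data.Integer using (+_)
open import Data.List using (List; []; _∷_; foldr; map; allFin; cartesianProductWith)
open import Data.Nat using (ℕ; zero; suc)
import Data.Nat as ℕ
import Data.Nat.Properties as ℕ
open import Data.Product using (∃-syntax; _×_; _,_)
open import Data.Rational using (ℚ; 0ℚ; 1ℚ; ½)
import Data.Rational as ℚ
import Data.Rational.Properties as ℚ
open import Data.Sum using (inj₁; inj₂)
open import Data.Vec using (Vec; []; _∷_; lookup; insertAt; count; _[_]≔_)
open import Data.Vec.Relation.Unary.All using (all?)
open import Relation.Binary.PropositionalEquality using (_≡_; cong; module ≡-Reasoning)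
open import Relation.Nullary using (does)
open import Algebra.Properties.AbelianGroup ℚ.+-0-abelianGroup using (⁻¹-∙-comm; ⁻¹-involutive)
open import Algebra.Properties.CommutativeSemigroup
  (CommutativeMonoid.commutativeSemigroup ℚ.+-0-commutativeMonoid)
  using (interchange)

------------------------------------------------------------------------
-- The real numbers, as Cauchy sequences of rationals. Equality of reals
-- is the setoid equality _≃_.

Eventually : (ℕ → Set) → Set
Eventually P = ∃[ N ] ∀ n → N ℕ.≤ n → P n

Cauchy : (ℕ → ℚ) → Set
Cauchy x = ∀ ε → 0ℚ ℚ.< ε →
  ∃[ N ] ∀ m n → N ℕ.≤ m → N ℕ.≤ n → ℚ.∣ x m ℚ.- x n ∣ ℚ.≤ ε

record ℝ : Set where
  constructor real
  field
    seq    : ℕ → ℚ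
    cauchy : Cauchy seq

open ℝ public

infix 4 _≤_ _<_ _≃_

record _≤_ (x y : ℝ) : Set where
  constructor *≤*
  field
    slack : ∀ ε → 0ℚ ℚ.< ε → Eventually λ n → seq x n ℚ.≤ seq y n ℚ.+ ε

open _≤_ public

record _<_ (x y : ℝ) : Set where
  constructor *<*
  field
    gap       : ℚ
    gap-pos   : 0ℚ ℚ.< gap
    separated : Eventually λ n → seq x n ℚ.+ gap ℚ.≤ seq y n

open _<_ public

_≃_ : ℝ → ℝ → Set
x ≃ y = x ≤ y × y ≤ x

------------------------------------------------------------------------
-- Distances between rationals

private
  ½-pos : ∀ {ε} → 0ℚ ℚ.< ε → 0ℚ ℚ.< ½ ℚ.* ε
  ½-pos {ε} 0<ε = ℚ.*-monoʳ-<-pos ½ 0<ε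

  halves : ∀ ε → ½ ℚ.* ε ℚ.+ ½ ℚ.* ε ≡ ε
  halves ε = begin
    ½ ℚ.* ε ℚ.+ ½ ℚ.* ε  ≡⟨ ℚ.*-distribʳ-+ ε ½ ½ ⟨
    1ℚ ℚ.* ε             ≡⟨ ℚ.*-identityˡ ε ⟩
    ε                    ∎
    where open ≡-Reasoning

  +-minus : ∀ a b c d → (a ℚ.+ b) ℚ.- (c ℚ.+ d) ≡ (a ℚ.- c) ℚ.+ (b ℚ.- d)
  +-minus a b c d = begin
    (a ℚ.+ b) ℚ.+ ℚ.- (c ℚ.+ d)          ≡⟨ cong ((a ℚ.+ b) ℚ.+_) (⁻¹-∙-comm c d) ⟨
    (a ℚ.+ b) ℚ.+ (ℚ.- c ℚ.+ ℚ.- d)      ≡⟨ interchange a b (ℚ.- c) (ℚ.- d) ⟩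
    (a ℚ.- c) ℚ.+ (b ℚ.- d)              ∎
    where open ≡-Reasoning

  minus-+ : ∀ p q → (p ℚ.- q) ℚ.+ q ≡ p
  minus-+ p q = begin
    (p ℚ.- q) ℚ.+ q      ≡⟨ ℚ.+-assoc p (ℚ.- q) q ⟩
    p ℚ.+ (ℚ.- q ℚ.+ q)  ≡⟨ cong (p ℚ.+_) (ℚ.+-inverseˡ q) ⟩
    p ℚ.+ 0ℚ             ≡⟨ ℚ.+-identityʳ p ⟩
    p                    ∎
    where open ≡-Reasoning

  plus-minus : ∀ p q → (p ℚ.+ q) ℚ.- p ≡ q
  plus-minus p q = begin
    (p ℚ.+ q) ℚ.- p      ≡⟨ cong (ℚ._- p) (ℚ.+-comm p q) ⟩
    (q ℚ.+ p) ℚ.- p      ≡⟨ ℚ.+-assoc q p (ℚ.- p) ⟩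
    q ℚ.+ (p ℚ.- p)      ≡⟨ cong (q ℚ.+_) (ℚ.+-inverseʳ p) ⟩
    q ℚ.+ 0ℚ             ≡⟨ ℚ.+-identityʳ q ⟩
    q                    ∎
    where open ≡-Reasoning

  neg-minus : ∀ p q → ℚ.- (p ℚ.- q) ≡ q ℚ.- p
  neg-minus p q = begin
    ℚ.- (p ℚ.+ ℚ.- q)        ≡⟨ ⁻¹-∙-comm p (ℚ.- q) ⟨
    ℚ.- p ℚ.+ ℚ.- (ℚ.- q)    ≡⟨ cong (ℚ.- p ℚ.+_) (⁻¹-involutive q) ⟩
    ℚ.- p ℚ.+ q              ≡⟨ ℚ.+-comm (ℚ.- p) q ⟩
    q ℚ.- p                  ∎
    where open ≡-Reasoning

p≤∣p∣ : ∀ p → p ℚ.≤ ℚ.∣ p ∣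
p≤∣p∣ p with ℚ.≤-total 0ℚ p
... | inj₁ 0≤p = ℚ.≤-reflexive (begin p ≡⟨ ℚ.0≤p⇒∣p∣≡p 0≤p ⟨ ℚ.∣ p ∣ ∎)
  where open ≡-Reasoning
... | inj₂ p≤0 = ℚ.≤-trans p≤0 (ℚ.0≤∣p∣ p)

dist-sym : ∀ p q → ℚ.∣ p ℚ.- q ∣ ≡ ℚ.∣ q ℚ.- p ∣
dist-sym p q = begin
  ℚ.∣ p ℚ.- q ∣          ≡⟨ ℚ.∣-p∣≡∣p∣ (p ℚ.- q) ⟨
  ℚ.∣ ℚ.- (p ℚ.- q) ∣    ≡⟨ cong ℚ.∣_∣ (neg-minus p q) ⟩
  ℚ.∣ q ℚ.- p ∣          ∎
  where open ≡-Reasoning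

dist⇒≤ : ∀ p q {ε} → ℚ.∣ p ℚ.- q ∣ ℚ.≤ ε → p ℚ.≤ q ℚ.+ ε
dist⇒≤ p q {ε} d = begin
  p                  ≡⟨ minus-+ p q ⟨
  (p ℚ.- q) ℚ.+ q    ≤⟨ ℚ.+-monoˡ-≤ q (ℚ.≤-trans (p≤∣p∣ (p ℚ.- q)) d) ⟩
  ε ℚ.+ q            ≡⟨ ℚ.+-comm ε q ⟩
  q ℚ.+ ε            ∎
  where open ℚ.≤-Reasoning

≤⇒dist : ∀ {p q ε} → p ℚ.≤ q ℚ.+ ε → q ℚ.≤ p ℚ.+ ε → ℚ.∣ p ℚ.- q ∣ ℚ.≤ ε
≤⇒dist {p} {q} {ε} p≤q+ε q≤p+ε with ℚ.∣p∣≡p∨∣p∣≡-p (p ℚ.- q)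
... | inj₁ eq = begin
  ℚ.∣ p ℚ.- q ∣      ≡⟨ eq ⟩
  p ℚ.- q            ≤⟨ ℚ.+-monoˡ-≤ (ℚ.- q) p≤q+ε ⟩
  (q ℚ.+ ε) ℚ.- q    ≡⟨ plus-minus q ε ⟩
  ε                  ∎
  where open ℚ.≤-Reasoning
... | inj₂ eq = begin
  ℚ.∣ p ℚ.- q ∣      ≡⟨ eq ⟩
  ℚ.- (p ℚ.- q)      ≡⟨ neg-minus p q ⟩
  q ℚ.- p            ≤⟨ ℚ.+-monoˡ-≤ (ℚ.- p) q≤p+ε ⟩
  (p ℚ.+ ε) ℚ.- p    ≡⟨ plus-minus p ε ⟩
  ε                  ∎
  where open ℚ.≤-Reasoning

p≤q⇒p≤q+ε : ∀ {p q ε} → p ℚ.≤ q → 0ℚ ℚ.< ε → p ℚ.≤ q ℚ.+ ε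
p≤q⇒p≤q+ε {p} {q} {ε} p≤q 0<ε = begin
  p            ≤⟨ p≤q ⟩
  q            ≡⟨ ℚ.+-identityʳ q ⟨
  q ℚ.+ 0ℚ     ≤⟨ ℚ.+-monoʳ-≤ q (ℚ.<⇒≤ 0<ε) ⟩
  q ℚ.+ ε      ∎
  where open ℚ.≤-Reasoning

⊔-≤-+ : ∀ a b c d {ε} → a ℚ.≤ c ℚ.+ ε → b ℚ.≤ d ℚ.+ ε → a ℚ.⊔ b ℚ.≤ (c ℚ.⊔ d) ℚ.+ ε
⊔-≤-+ a b c d {ε} a≤ b≤ = ℚ.⊔-lub
  (ℚ.≤-trans a≤ (ℚ.+-monoˡ-≤ ε (ℚ.p≤p⊔q c d)))
  (ℚ.≤-trans b≤ (ℚ.+-monoˡ-≤ ε (ℚ.p≤q⊔p c d)))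

------------------------------------------------------------------------
-- Operations on the reals

infixl 6 _+_ _⊔_

fromℚ : ℚ → ℝ
fromℚ q .seq _ = q
fromℚ q .cauchy ε 0<ε = 0 , λ _ _ _ _ →
  ℚ.≤-trans (ℚ.≤-reflexive (cong ℚ.∣_∣ (ℚ.+-inverseʳ q))) (ℚ.<⇒≤ 0<ε)

fromℕ : ℕ → ℝ
fromℕ n = fromℚ (+ n ℚ./ 1)

0ℝ 1ℝ : ℝ
0ℝ = fromℚ 0ℚ
1ℝ = fromℚ 1ℚ

_+_ : ℝ → ℝ → ℝ
(x + y) .seq n = seq x n ℚ.+ seq y n
(x + y) .cauchy ε 0<ε with cauchy x (½ ℚ.* ε) (½-pos 0<ε) | cauchy y (½ ℚ.* ε) (½-pos 0<ε)
... | M , hx | N , hy = M ℕ.⊔ N , λ m n p q → begin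
  ℚ.∣ (seq x m ℚ.+ seq y m) ℚ.- (seq x n ℚ.+ seq y n) ∣
    ≡⟨ cong ℚ.∣_∣ (+-minus (seq x m) (seq y m) (seq x n) (seq y n)) ⟩
  ℚ.∣ (seq x m ℚ.- seq x n) ℚ.+ (seq y m ℚ.- seq y n) ∣
    ≤⟨ ℚ.∣p+q∣≤∣p∣+∣q∣ (seq x m ℚ.- seq x n) (seq y m ℚ.- seq y n) ⟩
  ℚ.∣ seq x m ℚ.- seq x n ∣ ℚ.+ ℚ.∣ seq y m ℚ.- seq y n ∣
    ≤⟨ ℚ.+-mono-≤ (hx m n (ℕ.m⊔n≤o⇒m≤o M N p) (ℕ.m⊔n≤o⇒m≤o M N q))
                  (hy m n (ℕ.m⊔n≤o⇒n≤o M N p) (ℕ.m⊔n≤o⇒n≤o M N q)) ⟩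
  ½ ℚ.* ε ℚ.+ ½ ℚ.* ε
    ≡⟨ halves ε ⟩
  ε ∎
  where open ℚ.≤-Reasoning

_⊔_ : ℝ → ℝ → ℝ
(x ⊔ y) .seq n = seq x n ℚ.⊔ seq y n
(x ⊔ y) .cauchy ε 0<ε with cauchy x ε 0<ε | cauchy y ε 0<ε
... | M , hx | N , hy = M ℕ.⊔ N , λ m n p q →
  ≤⇒dist {seq x m ℚ.⊔ seq y m} {seq x n ℚ.⊔ seq y n} (bound m n p q) (bound n m q p)
  where
  bound : ∀ m n → M ℕ.⊔ N ℕ.≤ m → M ℕ.⊔ N ℕ.≤ n →
          seq x m ℚ.⊔ seq y m ℚ.≤ (seq x n ℚ.⊔ seq y n) ℚ.+ ε
  bound m n p q = ⊔-≤-+ (seq x m) (seq y m) (seq x n) (seq y n)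
    (dist⇒≤ (seq x m) (seq x n) (hx m n (ℕ.m⊔n≤o⇒m≤o M N p) (ℕ.m⊔n≤o⇒m≤o M N q)))
    (dist⇒≤ (seq y m) (seq y n) (hy m n (ℕ.m⊔n≤o⇒n≤o M N p) (ℕ.m⊔n≤o⇒n≤o M N q)))

fromℚ-mono-≤ : ∀ {p q} → p ℚ.≤ q → fromℚ p ≤ fromℚ q
fromℚ-mono-≤ p≤q .slack ε 0<ε = 0 , λ _ _ → p≤q⇒p≤q+ε p≤q 0<ε

≤-refl : ∀ {x} → x ≤ x
≤-refl .slack ε 0<ε = 0 , λ _ _ → p≤q⇒p≤q+ε ℚ.≤-refl 0<ε

≤-trans : ∀ {x y z} → x ≤ y → y ≤ z → x ≤ z
≤-trans {x} {y} {z} x≤y y≤z .slack ε 0<ε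
  with slack x≤y (½ ℚ.* ε) (½-pos 0<ε) | slack y≤z (½ ℚ.* ε) (½-pos 0<ε)
... | M , h | N , k = M ℕ.⊔ N , λ n p → begin
  seq x n                              ≤⟨ h n (ℕ.m⊔n≤o⇒m≤o M N p) ⟩
  seq y n ℚ.+ ½ ℚ.* ε                  ≤⟨ ℚ.+-monoˡ-≤ (½ ℚ.* ε) (k n (ℕ.m⊔n≤o⇒n≤o M N p)) ⟩
  (seq z n ℚ.+ ½ ℚ.* ε) ℚ.+ ½ ℚ.* ε    ≡⟨ ℚ.+-assoc (seq z n) _ _ ⟩
  seq z n ℚ.+ (½ ℚ.* ε ℚ.+ ½ ℚ.* ε)    ≡⟨ cong (seq z n ℚ.+_) (halves ε) ⟩
  seq z n ℚ.+ ε                        ∎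
  where open ℚ.≤-Reasoning

x≤x⊔y : ∀ x y → x ≤ x ⊔ y
x≤x⊔y x y .slack ε 0<ε = 0 , λ n _ → p≤q⇒p≤q+ε (ℚ.p≤p⊔q (seq x n) (seq y n)) 0<ε

⊔-lub : ∀ {x y z} → x ≤ z → y ≤ z → x ⊔ y ≤ z
⊔-lub x≤z y≤z .slack ε 0<ε with slack x≤z ε 0<ε | slack y≤z ε 0<ε
... | M , h | N , k = M ℕ.⊔ N , λ n p →
  ℚ.⊔-lub (h n (ℕ.m⊔n≤o⇒m≤o M N p)) (k n (ℕ.m⊔n≤o⇒n≤o M N p))

0≤1 : 0ℝ ≤ 1ℝ
0≤1 = fromℚ-mono-≤ (ℚ.nonNegative⁻¹ 1ℚ)

------------------------------------------------------------------------
-- The unit interval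

record [0,1] : Set where
  constructor unit
  field
    value : ℝ
    0≤    : 0ℝ ≤ value
    ≤1    : value ≤ 1ℝ

open [0,1] public

0ᴵ 1ᴵ : [0,1]
0ᴵ = unit 0ℝ ≤-refl 0≤1
1ᴵ = unit 1ℝ 0≤1 ≤-refl

_⊔ᴵ_ : [0,1] → [0,1] → [0,1]
(a ⊔ᴵ b) .value = value a ⊔ value b
(a ⊔ᴵ b) .0≤ = ≤-trans (0≤ a) (x≤x⊔y (value a) (value b))
(a ⊔ᴵ b) .≤1 = ⊔-lub (≤1 a) (≤1 b)

-- 0ᴵ is the least element of [0,1], so for a nonempty list this is the
-- maximum of its members.
maximum : List [0,1] → [0,1]
maximum = foldr _⊔ᴵ_ 0ᴵ

------------------------------------------------------------------------
-- Fractional families. The alphabet {1,…,r} is Fin r, with a : Fin r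
-- standing for the symbol suc (toℕ a).

Word : ℕ → ℕ → Set
Word r n = Vec (Fin r) n

words : ∀ r n → List (Word r n)
words r zero    = [] ∷ []
words r (suc n) = cartesianProductWith _∷_ (allFin r) (words r n)

Family : ℕ → ℕ → Set
Family r n = Word r n → [0,1]

∣_∣ : ∀ {r n} → Family r n → ℝ
∣_∣ {r} {n} f = foldr _+_ 0ℝ (map (λ w → value (f w)) (words r n))

Δ : ∀ {r n} → Family r (suc n) → Family r n
Δ {r} {n} f x =
  maximum (cartesianProductWith (λ y i → f (insertAt x i y)) (allFin r) (allFin (suc n)))

ball : ∀ {r} n → Fin r → ℕ → [0,1] → Family r n
ball n s k α w =
  if does (all? (Fin._≤? s) w)
  then (if does (count (Fin._≟ s) w ℕ.≤? k) then 1ᴵ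
        else if does (count (Fin._≟ s) w ℕ.≟ suc k) then α
        else 0ᴵ)
  else 0ᴵ

Compressed : ∀ {r n} → Fin r → Family r n → Set
Compressed {r} {n} ℓ f = ∀ (x : Word r n) (y : Fin r) (i : Fin n) →
  y Fin.< lookup x i → ℓ Fin.≤ lookup x i →
  0ℝ < value (f x) → value (f (x [ i ]≔ y)) ≃ 1ℝ

{-# OPTIONS --safe #-}

-- Put q = s − 1 and let B n j count the words of [s]ⁿ with fewer than j copies of s. For q ≥ 1 the
-- absorption identity (n − k) C(n, k) = n C(n − 1, k) turns the theorem into the concave bound
--   n q ∣Δf∣ ≥ min(∣f∣, B n 1) + ⋯ + min(∣f∣, B n n),
-- with equality for balls. Split f by the first letter into fibres f_y. Then ∣Δf∣ dominates every
-- ∣f_y∣ (insert y in front) and also ∑ ∣Δf_y∣, to which induction applies. If ∣Δf∣ were less than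
-- the common weight W of the first q fibres of the ball of weight ∣f∣, all ∣f_y∣ would be at most W,
-- and by Karamata ∑ ∣Δf_y∣ would be smallest for the fibre weights of that ball, where it equals W.
-- Compression is needed only for n = 1. For q = 0 the bound becomes ∣Δf∣ ≥ ∣f∣, by the same splitting.
--
-- The argument is run on rational approximations at a large index of the Cauchy sequences, since
-- there the order is decidable; only the case n = 1 has to cope with approximate compression.
module Submission where

module _ where

  open import Defs as D using
    ( Word; words; Family; ∣_∣; Δ; ball; Compressed; [0,1]; value; maximum
    ; ℝ; seq; cauchy; slack; 0ℝ; 1ℝ; fromℕ; Eventually; dist⇒≤ )
  open import Data.Bool using (if_then_else_; true; false)
  open import Data.Fin using (Fin; zero; suc; toℕ)
  import Data.Fin as Fin
  import Data.Fin.Properties as Fin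
  open import Data.List using (List; []; _∷_; _++_; foldr; map; allFin; cartesianProductWith)
  open import Data.List.Membership.Propositional using (_∈_)
  open import Data.List.Membership.Propositional.Properties
    using (∈-allFin; ∈-cartesianProductWith⁺; ∈-cartesianProductWith⁻)
  open import Data.List.Properties using (map-tabulate)
  open import Data.List.Relation.Unary.Any using (here; there)
  open import Data.Nat using (ℕ; zero; suc; _^_)
  import Data.Nat as ℕ
  import Data.Nat.Properties as ℕ
  open import Data.Product using (∃-syntax; _×_; _,_; proj₂)
  open import Data.Rational
    using (ℚ; 0ℚ; 1ℚ; ½; _+_; _*_; _-_; -_; 1/_; _⊓_; _⊔_; _≤_; _<_; Positive; NonZero; positive; nonNegative)
  open import Data.Rational.Properties
  open import Data.Rational.Solver using (module +-*-Solver)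
  open import Data.Sum using (_⊎_; inj₁; inj₂)
  open import Data.Vec using (Vec; []; _∷_; insertAt; count; lookup; _[_]≔_)
  open import Data.Vec.Properties using (insertAt-lookup)
  open import Data.Vec.Relation.Unary.All using (all?)
  open import Function using (_∘_; id)
  open import Relation.Binary.Definitions using (tri<; tri≈; tri>)
  open import Relation.Binary.PropositionalEquality
  open import Relation.Nullary using (does; yes; no; contradiction)
  open import Relation.Nullary.Decidable using (dec-true; dec-false)
  open +-*-Solver using (solve; _:=_; _:+_; _:*_; _:-_; con)

  -- Rational arithmetic and order

  ≤-by : ∀ {x y z} → 0ℚ ≤ z → x + z ≡ y → x ≤ y
  ≤-by {x} {y} {z} 0≤z x+z≡y = begin
    x        ≡⟨ +-identityʳ x ⟨
    x + 0ℚ   ≤⟨ +-monoʳ-≤ x 0≤z ⟩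
    x + z    ≡⟨ x+z≡y ⟩
    y        ∎
    where open ≤-Reasoning

  p≤p+q : ∀ p {q} → 0ℚ ≤ q → p ≤ p + q
  p≤p+q p 0≤q = ≤-by 0≤q refl

  0≤-diff : ∀ {x y} → x ≤ y → 0ℚ ≤ y - x
  0≤-diff {x} {y} x≤y = ≤-trans (≤-reflexive (sym (+-inverseʳ x))) (+-monoˡ-≤ (- x) x≤y)

  0≤-+ : ∀ {x y} → 0ℚ ≤ x → 0ℚ ≤ y → 0ℚ ≤ x + y
  0≤-+ = +-mono-≤

  0≤-* : ∀ {x y} → 0ℚ ≤ x → 0ℚ ≤ y → 0ℚ ≤ x * y
  0≤-* {x} {y} 0≤x 0≤y = nonNegative⁻¹ (x * y)
    {{nonNeg*nonNeg⇒nonNeg x {{nonNegative 0≤x}} y {{nonNegative 0≤y}}}}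

  0≤1ℚ : 0ℚ ≤ 1ℚ
  0≤1ℚ = nonNegative⁻¹ 1ℚ

  *-monoˡ : ∀ {c x y} → 0ℚ ≤ c → x ≤ y → c * x ≤ c * y
  *-monoˡ {c} 0≤c = *-monoˡ-≤-nonNeg c {{nonNegative 0≤c}}

  ⊓-≤-+ : ∀ x y {e} → 0ℚ ≤ e → (x + e) ⊓ y ≤ x ⊓ y + e
  ⊓-≤-+ x y {e} 0≤e with ≤-total x y
  ... | inj₁ x≤y rewrite p≤q⇒p⊓q≡p x≤y = p⊓q≤p (x + e) y
  ... | inj₂ y≤x rewrite p≥q⇒p⊓q≡q y≤x = ≤-trans (p⊓q≤q (x + e) y) (p≤p+q y 0≤e)

  -- Recursive rather than a fraction, so that `fromNat (suc n)` unfolds to `1ℚ + fromNat n` and the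
  -- ring solver can work with the successor.
  fromNat : ℕ → ℚ
  fromNat zero    = 0ℚ
  fromNat (suc n) = 1ℚ + fromNat n

  0≤fromNat : ∀ n → 0ℚ ≤ fromNat n
  0≤fromNat zero    = ≤-refl
  0≤fromNat (suc n) = 0≤-+ 0≤1ℚ (0≤fromNat n)

  fromNat-pos : ∀ n → Positive (fromNat (suc n))
  fromNat-pos n = pos+nonNeg⇒pos 1ℚ (fromNat n) {{nonNegative (0≤fromNat n)}}

  -- Finite sums and a Karamata inequality

  ∑ : ∀ {A : Set} → List A → (A → ℚ) → ℚ
  ∑ xs g = foldr _+_ 0ℚ (map g xs)

  ∑[1⋯_] : ℕ → (ℕ → ℚ) → ℚ
  ∑[1⋯ zero ]  g = 0ℚ
  ∑[1⋯ suc n ] g = ∑[1⋯ n ] g + g (suc n)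

  module _ {A : Set} where

    ∑-mono : ∀ (xs : List A) {g h} → (∀ x → g x ≤ h x) → ∑ xs g ≤ ∑ xs h
    ∑-mono []       g≤h = ≤-refl
    ∑-mono (x ∷ xs) g≤h = +-mono-≤ (g≤h x) (∑-mono xs g≤h)

    ∑-cong : ∀ (xs : List A) {g h} → (∀ x → g x ≡ h x) → ∑ xs g ≡ ∑ xs h
    ∑-cong []       g≡h = refl
    ∑-cong (x ∷ xs) g≡h = cong₂ _+_ (g≡h x) (∑-cong xs g≡h)

    ∑-0 : ∀ (xs : List A) → ∑ xs (λ _ → 0ℚ) ≡ 0ℚ
    ∑-0 []       = refl
    ∑-0 (x ∷ xs) = trans (+-identityˡ _) (∑-0 xs)

    ∑-nonneg : ∀ (xs : List A) {g} → (∀ x → 0ℚ ≤ g x) → 0ℚ ≤ ∑ xs g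
    ∑-nonneg xs 0≤g = ≤-trans (≤-reflexive (sym (∑-0 xs))) (∑-mono xs 0≤g)

    ∑-+ : ∀ (xs : List A) g h → ∑ xs (λ x → g x + h x) ≡ ∑ xs g + ∑ xs h
    ∑-+ []       g h = refl
    ∑-+ (x ∷ xs) g h rewrite ∑-+ xs g h =
      solve 4 (λ a b c d → (a :+ b) :+ (c :+ d) := (a :+ c) :+ (b :+ d)) refl
        (g x) (h x) (∑ xs g) (∑ xs h)

    ∑-*ˡ : ∀ (xs : List A) c g → ∑ xs (λ x → c * g x) ≡ c * ∑ xs g
    ∑-*ˡ []       c g = sym (*-zeroʳ c)
    ∑-*ˡ (x ∷ xs) c g rewrite ∑-*ˡ xs c g = sym (*-distribˡ-+ c (g x) (∑ xs g))

    ∑-∈ : ∀ {xs : List A} {g x} → (∀ x → 0ℚ ≤ g x) → x ∈ xs → g x ≤ ∑ xs g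
    ∑-∈ {g = g} {x} 0≤g (here {xs = xs} refl) = p≤p+q (g x) (∑-nonneg xs 0≤g)
    ∑-∈ {g = g} {x} 0≤g (there {y} {xs} x∈xs) =
      ≤-trans (∑-∈ 0≤g x∈xs) (≤-by (0≤g y) (+-comm (∑ xs g) (g y)))

    ∑-swap : ∀ (xs : List A) n (g : A → ℕ → ℚ) →
             ∑ xs (λ x → ∑[1⋯ n ] (g x)) ≡ ∑[1⋯ n ] (λ j → ∑ xs (λ x → g x j))
    ∑-swap xs zero    g = ∑-0 xs
    ∑-swap xs (suc n) g = trans
      (∑-+ xs (λ x → ∑[1⋯ n ] (g x)) (λ x → g x (suc n)))
      (cong (_+ ∑ xs (λ x → g x (suc n))) (∑-swap xs n g))

  -- Karamata's inequality for min(·, t): the extremal sequence is q copies of D and one c.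
  ∑-⊓-lower : ∀ {A : Set} (xs : List A) g {D t} q c → 0ℚ ≤ t → t ≤ D → (∀ x → 0ℚ ≤ g x) → (∀ x → g x ≤ D) →
              fromNat q * D + c ≤ ∑ xs g →
              fromNat q * t + c ⊓ t ≤ ∑ xs (λ x → g x ⊓ t)
  ∑-⊓-lower [] g {D} {t} q c 0≤t t≤D 0≤g g≤D qD+c≤ = begin
    fromNat q * t + c ⊓ t  ≤⟨ +-mono-≤ (*-monoˡ (0≤fromNat q) t≤D) (p⊓q≤p c t) ⟩
    fromNat q * D + c      ≤⟨ qD+c≤ ⟩
    0ℚ                     ∎
    where open ≤-Reasoning
  ∑-⊓-lower (x ∷ xs) g {D} {t} q c 0≤t t≤D 0≤g g≤D qD+c≤ with ≤-total (g x) t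
  -- An entry at most `t` counts in full. It is charged to `c`, which may turn negative, while the
  -- `q` copies of `D` stay.
  ... | inj₁ gx≤t rewrite p≤q⇒p⊓q≡p gx≤t = begin
    fromNat q * t + c ⊓ t
      ≡⟨ cong (λ z → fromNat q * t + z ⊓ t) (solve 2 (λ c a → c := (c :- a) :+ a) refl c (g x)) ⟩
    fromNat q * t + (c - g x + g x) ⊓ t      ≤⟨ +-monoʳ-≤ (fromNat q * t) (⊓-≤-+ (c - g x) t (0≤g x)) ⟩
    fromNat q * t + ((c - g x) ⊓ t + g x)
      ≡⟨ solve 3 (λ a b c → a :+ (b :+ c) := c :+ (a :+ b)) refl (fromNat q * t) ((c - g x) ⊓ t) (g x) ⟩
    g x + (fromNat q * t + (c - g x) ⊓ t)    ≤⟨ +-monoʳ-≤ (g x) (∑-⊓-lower xs g q (c - g x) 0≤t t≤D 0≤g g≤D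
        (≤-by (0≤-diff qD+c≤)
          (solve 4 (λ a c x s → (a :+ (c :- x)) :+ ((x :+ s) :- (a :+ c)) := s) refl
            (fromNat q * D) c (g x) (∑ xs g)))) ⟩
    g x + ∑ xs (λ x → g x ⊓ t)               ∎
    where open ≤-Reasoning
  -- With no copy of `D` left, this entry alone contributes `t`, and the rest of the sum is
  -- nonnegative.
  ∑-⊓-lower (x ∷ xs) g {D} {t} zero c 0≤t t≤D 0≤g g≤D qD+c≤ | inj₂ t≤gx rewrite p≥q⇒p⊓q≡q t≤gx = begin
    0ℚ * t + c ⊓ t               ≡⟨ cong (_+ c ⊓ t) (*-zeroˡ t) ⟩
    0ℚ + c ⊓ t                   ≡⟨ +-identityˡ (c ⊓ t) ⟩
    c ⊓ t                        ≤⟨ p⊓q≤q c t ⟩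
    t                            ≤⟨ ≤-by (∑-nonneg xs (λ x → ⊓-glb (0≤g x) 0≤t)) refl ⟩
    t + ∑ xs (λ x → g x ⊓ t)     ∎
    where open ≤-Reasoning
  -- An entry of at least `t` contributes `t` and uses up one copy of `D`. Being at most `D`, it
  -- leaves enough weight for the other copies and `c`.
  ∑-⊓-lower (x ∷ xs) g {D} {t} (suc q) c 0≤t t≤D 0≤g g≤D qD+c≤ | inj₂ t≤gx rewrite p≥q⇒p⊓q≡q t≤gx = begin
    (1ℚ + fromNat q) * t + c ⊓ t
      ≡⟨ solve 3 (λ q t m → (con 1ℚ :+ q) :* t :+ m := t :+ (q :* t :+ m)) refl (fromNat q) t (c ⊓ t) ⟩
    t + (fromNat q * t + c ⊓ t)      ≤⟨ +-monoʳ-≤ t (∑-⊓-lower xs g q c 0≤t t≤D 0≤g g≤D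
                                          (≤-by (0≤-+ (0≤-diff qD+c≤) (0≤-diff (g≤D x)))
                                            (solve 5 (λ q D c x s → (q :* D :+ c) :+ (((x :+ s) :- ((con 1ℚ :+ q) :* D :+ c)) :+ (D :- x)) := s)
                                              refl (fromNat q) D c (g x) (∑ xs g)))) ⟩
    t + ∑ xs (λ x → g x ⊓ t)         ∎
    where open ≤-Reasoning

  -- Sums over indices from 1 to n

  ∑[1⋯]-mono : ∀ n {g h : ℕ → ℚ} → (∀ j → j ℕ.≤ n → g j ≤ h j) → ∑[1⋯ n ] g ≤ ∑[1⋯ n ] h
  ∑[1⋯]-mono zero    g≤h = ≤-refl
  ∑[1⋯]-mono (suc n) g≤h =
    +-mono-≤ (∑[1⋯]-mono n (λ j j≤n → g≤h j (ℕ.m≤n⇒m≤1+n j≤n))) (g≤h (suc n) ℕ.≤-refl)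

  ∑[1⋯]-+ : ∀ n (g h : ℕ → ℚ) → ∑[1⋯ n ] (λ j → g j + h j) ≡ ∑[1⋯ n ] g + ∑[1⋯ n ] h
  ∑[1⋯]-+ zero    g h = refl
  ∑[1⋯]-+ (suc n) g h rewrite ∑[1⋯]-+ n g h =
    solve 4 (λ a b c d → (a :+ b) :+ (c :+ d) := (a :+ c) :+ (b :+ d)) refl
      (∑[1⋯ n ] g) (∑[1⋯ n ] h) (g (suc n)) (h (suc n))

  ∑[1⋯]-*ˡ : ∀ n c (g : ℕ → ℚ) → ∑[1⋯ n ] (λ j → c * g j) ≡ c * ∑[1⋯ n ] g
  ∑[1⋯]-*ˡ zero    c g = sym (*-zeroʳ c)
  ∑[1⋯]-*ˡ (suc n) c g rewrite ∑[1⋯]-*ˡ n c g = sym (*-distribˡ-+ c (∑[1⋯ n ] g) (g (suc n)))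

  ∑[1⋯]-const : ∀ n c → ∑[1⋯ n ] (λ _ → c) ≡ fromNat n * c
  ∑[1⋯]-const zero    c = sym (*-zeroˡ c)
  ∑[1⋯]-const (suc n) c rewrite ∑[1⋯]-const n c =
    solve 2 (λ n c → n :* c :+ c := (con 1ℚ :+ n) :* c) refl (fromNat n) c

  fromNat-mono : ∀ {m n} → m ℕ.≤ n → fromNat m ≤ fromNat n
  fromNat-mono {n = n} ℕ.z≤n   = 0≤fromNat n
  fromNat-mono (ℕ.s≤s m≤n) = +-monoʳ-≤ 1ℚ (fromNat-mono m≤n)

  ∑[1⋯]-tail-≤ : ∀ {k n c} {g : ℕ → ℚ} → k ℕ.≤ n → (∀ j → k ℕ.< j → j ℕ.≤ n → g j ≤ c) →
                 ∑[1⋯ n ] g ≤ ∑[1⋯ k ] g + (fromNat n - fromNat k) * c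
  ∑[1⋯]-tail-≤ {k} {n} {c} {g} k≤n = go (ℕ.≤⇒≤′ k≤n)
    where
    go : ∀ {n} → k ℕ.≤′ n → (∀ j → k ℕ.< j → j ℕ.≤ n → g j ≤ c) →
         ∑[1⋯ n ] g ≤ ∑[1⋯ k ] g + (fromNat n - fromNat k) * c
    go (ℕ.≤′-reflexive refl) g≤c = ≤-reflexive
      (solve 3 (λ s k c → s := s :+ (k :- k) :* c) refl (∑[1⋯ k ] g) (fromNat k) c)
    go {suc n} (ℕ.≤′-step k≤n) g≤c = ≤-trans
      (+-mono-≤ (go k≤n (λ j k<j j≤n → g≤c j k<j (ℕ.m≤n⇒m≤1+n j≤n))) (g≤c (suc n) (ℕ.s≤s (ℕ.≤′⇒≤ k≤n)) ℕ.≤-refl))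
      (≤-reflexive (solve 4 (λ s n k c → s :+ (n :- k) :* c :+ c := s :+ ((con 1ℚ :+ n) :- k) :* c) refl
        (∑[1⋯ k ] g) (fromNat n) (fromNat k) c))

  ∑[1⋯]-tail-≥ : ∀ {k n c} {g : ℕ → ℚ} → k ℕ.≤ n → (∀ j → k ℕ.< j → c ≤ g j) →
                 ∑[1⋯ k ] g + (fromNat n - fromNat k) * c ≤ ∑[1⋯ n ] g
  ∑[1⋯]-tail-≥ {k} {n} {c} {g} k≤n c≤g = go (ℕ.≤⇒≤′ k≤n)
    where
    go : ∀ {n} → k ℕ.≤′ n → ∑[1⋯ k ] g + (fromNat n - fromNat k) * c ≤ ∑[1⋯ n ] g
    go (ℕ.≤′-reflexive refl) = ≤-reflexive
      (solve 3 (λ s k c → s :+ (k :- k) :* c := s) refl (∑[1⋯ k ] g) (fromNat k) c)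
    go {suc n} (ℕ.≤′-step k≤n) = ≤-trans
      (≤-reflexive (solve 4 (λ s n k c → s :+ ((con 1ℚ :+ n) :- k) :* c := s :+ (n :- k) :* c :+ c) refl
        (∑[1⋯ k ] g) (fromNat n) (fromNat k) c))
      (+-mono-≤ (go k≤n) (c≤g (suc n) (ℕ.s≤s (ℕ.≤′⇒≤ k≤n))))

  -- Descends from the top index until the value of `b` is at most `x`, which is possible because
  -- the order of `ℚ` is decidable.
  bracket : ∀ (b : ℕ → ℚ) n {x} → b 0 ≤ x → x ≤ b (suc n) →
            ∃[ k ] k ℕ.≤ n × b k ≤ x × x ≤ b (suc k)
  bracket b zero    b₀≤x x≤b = 0 , ℕ.z≤n , b₀≤x , x≤b
  bracket b (suc n) {x} b₀≤x x≤b with ≤-total x (b (suc n))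
  ... | inj₂ bₙ≤x = suc n , ℕ.≤-refl , bₙ≤x , x≤b
  ... | inj₁ x≤bₙ with bracket b n b₀≤x x≤bₙ
  ...   | k , k≤n , bₖ≤x , x≤bₖ₊₁ = k , ℕ.m≤n⇒m≤1+n k≤n , bₖ≤x , x≤bₖ₊₁

  -- Sizes of Hamming balls

  module _ (q : ℕ) where

    -- The number of words of length n over q + 1 letters with fewer than k occurrences of the
    -- last letter. The shift in k makes room for the empty ball.
    B : ℕ → ℕ → ℚ
    B n       zero    = 0ℚ
    B zero    (suc k) = 1ℚ
    B (suc n) (suc k) = fromNat q * B n (suc k) + B n k

    B-step : ∀ n k → B n k ≤ B n (suc k)
    B-step zero    zero    = 0≤1ℚ
    B-step zero    (suc k) = ≤-refl
    B-step (suc n) zero    = 0≤-+ (0≤-* (0≤fromNat q) (B-step n zero)) ≤-refl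
    B-step (suc n) (suc k) = +-mono-≤ (*-monoˡ (0≤fromNat q) (B-step n (suc k))) (B-step n k)

    B-mono : ∀ n {j k} → j ℕ.≤ k → B n j ≤ B n k
    B-mono n {j} j≤k = go (ℕ.≤⇒≤′ j≤k)
      where
      go : ∀ {k} → j ℕ.≤′ k → B n j ≤ B n k
      go (ℕ.≤′-reflexive refl)   = ≤-refl
      go {suc k} (ℕ.≤′-step j≤k) = ≤-trans (go j≤k) (B-step n k)

    -- By the recursion for `B` the right side is `B n (k - 1)`; written this way it can be
    -- evaluated through `∑B`.
    B-pascal-≥ : ∀ n {j k} → j ℕ.< k → B n j ≤ B (suc n) k - fromNat q * B n k
    B-pascal-≥ n {j} {suc k} (ℕ.s≤s j≤k) = ≤-trans (B-mono n j≤k)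
      (≤-reflexive (solve 2 (λ a b → b := a :+ b :- a) refl (fromNat q * B n (suc k)) (B n k)))

    0≤B : ∀ n k → 0ℚ ≤ B n k
    0≤B n k = B-mono n {zero} {k} ℕ.z≤n

    -- This is (n + 1 − k) C(n + 1, k) = (n + 1) C(n, k), each side times q^(n + 1 − k).
    absorption : ∀ n k → (fromNat (suc n) - fromNat k) * (B (suc n) (suc k) - B (suc n) k)
                       ≡ fromNat (suc n) * fromNat q * (B n (suc k) - B n k)
    absorption n zero =
      solve 3 (λ n q b → ((con 1ℚ :+ n) :- con 0ℚ) :* ((q :* b :+ con 0ℚ) :- con 0ℚ)
                       := (con 1ℚ :+ n) :* q :* (b :- con 0ℚ)) refl (fromNat n) (fromNat q) (B n 1)
    absorption zero (suc zero) =
      solve 1 (λ q → ((con 1ℚ :+ con 0ℚ) :- (con 1ℚ :+ con 0ℚ)) :* ((q :* con 1ℚ :+ con 1ℚ) :- (q :* con 1ℚ :+ con 0ℚ))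
                   := (con 1ℚ :+ con 0ℚ) :* q :* (con 1ℚ :- con 1ℚ)) refl (fromNat q)
    absorption zero (suc (suc k)) =
      solve 2 (λ q k → ((con 1ℚ :+ con 0ℚ) :- (con 1ℚ :+ (con 1ℚ :+ k))) :* ((q :* con 1ℚ :+ con 1ℚ) :- (q :* con 1ℚ :+ con 1ℚ))
                   := (con 1ℚ :+ con 0ℚ) :* q :* (con 1ℚ :- con 1ℚ)) refl (fromNat q) (fromNat k)
    absorption (suc n) (suc k) = begin
      (1ℚ + N - (1ℚ + K)) * ((Q * b₂ + b₁) - (Q * b₁ + b₀))
        ≡⟨ solve 6 (λ N K Q b₀ b₁ b₂ → ((con 1ℚ :+ N) :- (con 1ℚ :+ K)) :* ((Q :* b₂ :+ b₁) :- (Q :* b₁ :+ b₀))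
             := Q :* ((N :- (con 1ℚ :+ K)) :* (b₂ :- b₁)) :+ (N :- K) :* (b₁ :- b₀) :+ Q :* (b₂ :- b₁)) refl N K Q b₀ b₁ b₂ ⟩
      Q * ((N - (1ℚ + K)) * (b₂ - b₁)) + (N - K) * (b₁ - b₀) + Q * (b₂ - b₁)
        ≡⟨ cong₂ (λ x y → Q * x + y + Q * (b₂ - b₁)) (absorption n (suc k)) (absorption n k) ⟩
      Q * (N * Q * (c₂ - c₁)) + N * Q * (c₁ - c₀) + Q * (b₂ - b₁)
        ≡⟨ solve 5 (λ N Q c₀ c₁ c₂ → Q :* (N :* Q :* (c₂ :- c₁)) :+ N :* Q :* (c₁ :- c₀) :+ Q :* ((Q :* c₂ :+ c₁) :- (Q :* c₁ :+ c₀))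
             := (con 1ℚ :+ N) :* Q :* ((Q :* c₂ :+ c₁) :- (Q :* c₁ :+ c₀))) refl N Q c₀ c₁ c₂ ⟩
      (1ℚ + N) * Q * (b₂ - b₁) ∎
      where
      open ≡-Reasoning
      N = fromNat (suc n)
      K = fromNat k
      Q = fromNat q
      b₀ = B (suc n) k
      b₁ = B (suc n) (suc k)
      b₂ = B (suc n) (suc (suc k))
      c₀ = B n k
      c₁ = B n (suc k)
      c₂ = B n (suc (suc k))

    -- `absorption` summed by parts over `k`. For `k` at most `suc n`, monotonicity turns the right
    -- side into the sum of the minima of `B (suc n) k` and `B (suc n) j`, so integral balls attain
    -- the concave bound.
    ∑B : ∀ n k → fromNat (suc n) * fromNat q * B n k
               ≡ ∑[1⋯ k ] (B (suc n)) + (fromNat (suc n) - fromNat k) * B (suc n) k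
    ∑B n zero = solve 2 (λ a n → a :* con 0ℚ := con 0ℚ :+ n :* con 0ℚ) refl
      (fromNat (suc n) * fromNat q) (fromNat (suc n) - 0ℚ)
    ∑B n (suc k) = begin
      M * c₁
        ≡⟨ solve 3 (λ M x y → M :* x := M :* (x :- y) :+ M :* y) refl M c₁ c₀ ⟩
      M * (c₁ - c₀) + M * c₀                 ≡⟨ cong₂ _+_ (sym (absorption n k)) (∑B n k) ⟩
      (N - K) * (b₁ - b₀) + (S + (N - K) * b₀)
        ≡⟨ solve 5 (λ N K b₀ b₁ S → (N :- K) :* (b₁ :- b₀) :+ (S :+ (N :- K) :* b₀)
             := S :+ b₁ :+ (N :- (con 1ℚ :+ K)) :* b₁) refl N K b₀ b₁ S ⟩
      S + b₁ + (N - (1ℚ + K)) * b₁           ∎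
      where
      open ≡-Reasoning
      N = fromNat (suc n)
      K = fromNat k
      M = fromNat (suc n) * fromNat q
      S = ∑[1⋯ k ] (B (suc n))
      b₀ = B (suc n) k
      b₁ = B (suc n) (suc k)
      c₀ = B n k
      c₁ = B n (suc k)

    ∑B-min : ∀ n k → fromNat (suc n) * fromNat q * B n k ≤ ∑[1⋯ suc n ] (λ j → B (suc n) k ⊓ B (suc n) j)
    ∑B-min n k = begin
      fromNat (suc n) * fromNat q * B n k
        ≡⟨ ∑B n k ⟩
      ∑[1⋯ k ] b + (N - fromNat k) * b k
        ≤⟨ bound (suc n) ⟩
      ∑[1⋯ suc n ] (λ j → b k ⊓ b j) ∎
      where
      open ≤-Reasoning
      N = fromNat (suc n)
      b = B (suc n)
      below : ∀ m → m ℕ.≤ k → ∑[1⋯ m ] b ≤ ∑[1⋯ m ] (λ j → b k ⊓ b j)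
      below m m≤k = ∑[1⋯]-mono m λ j j≤m → ⊓-glb (B-mono (suc n) (ℕ.≤-trans j≤m m≤k)) ≤-refl
      bound : ∀ m → ∑[1⋯ k ] b + (fromNat m - fromNat k) * b k ≤ ∑[1⋯ m ] (λ j → b k ⊓ b j)
      bound m with ℕ.≤-total m k
      -- The index of a ball may exceed the word length. The coefficient of `b k` is then negative
      -- and pays for the surplus terms of the sum up to `k`, each at most `b k`.
      ... | inj₁ m≤k = begin
        ∑[1⋯ k ] b + (fromNat m - fromNat k) * b k
          ≤⟨ +-monoˡ-≤ _ (∑[1⋯]-tail-≤ m≤k (λ j _ j≤k → B-mono (suc n) j≤k)) ⟩
        ∑[1⋯ m ] b + (fromNat k - fromNat m) * b k + (fromNat m - fromNat k) * b k
          ≡⟨ solve 4 (λ s k m b → s :+ (k :- m) :* b :+ (m :- k) :* b := s) refl (∑[1⋯ m ] b) (fromNat k) (fromNat m) (b k) ⟩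
        ∑[1⋯ m ] b
          ≤⟨ below m m≤k ⟩
        ∑[1⋯ m ] (λ j → b k ⊓ b j) ∎
      ... | inj₂ k≤m = ≤-trans (+-monoˡ-≤ _ (below k ℕ.≤-refl))
        (∑[1⋯]-tail-≥ k≤m λ j k<j → ⊓-glb ≤-refl (B-mono (suc n) (ℕ.<⇒≤ k<j)))

    -- Pascal's rule summed over `j`: the terms `B n (j - 1)` start with `B n 0`, which is zero, and
    -- lack only `B n k` to form another copy of the sum.
    ∑B-pascal : ∀ n k → ∑[1⋯ k ] (B (suc n)) + B n k ≡ (1ℚ + fromNat q) * ∑[1⋯ k ] (B n)
    ∑B-pascal n zero    = sym (*-zeroʳ (1ℚ + fromNat q))
    ∑B-pascal n (suc k) = begin
      S + (Q * b₁ + b₀) + b₁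
        ≡⟨ solve 4 (λ S Q b₀ b₁ → S :+ (Q :* b₁ :+ b₀) :+ b₁ := (S :+ b₀) :+ (con 1ℚ :+ Q) :* b₁) refl S Q b₀ b₁ ⟩
      (S + b₀) + (1ℚ + Q) * b₁        ≡⟨ cong (_+ (1ℚ + Q) * b₁) (∑B-pascal n k) ⟩
      (1ℚ + Q) * T + (1ℚ + Q) * b₁    ≡⟨ *-distribˡ-+ (1ℚ + Q) T b₁ ⟨
      (1ℚ + Q) * (T + b₁)             ∎
      where
      open ≡-Reasoning
      Q = fromNat q
      S = ∑[1⋯ k ] (B (suc n))
      T = ∑[1⋯ k ] (B n)
      b₀ = B n k
      b₁ = B n (suc k)

    -- As `v` lies between `B n (k - 1)` and `B n k`, taking minima with `v` changes only the last
    -- term of the sum, from `B n k` to `v`.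
    ∑⊓B-lower : ∀ n k {v} → v ≤ B n k → (∀ j → j ℕ.< k → B n j ≤ v) →
                ∑[1⋯ k ] (B n) + v ≤ ∑[1⋯ k ] (λ j → v ⊓ B n j) + B n k
    ∑⊓B-lower n zero    v≤b b≤v = +-monoʳ-≤ 0ℚ v≤b
    ∑⊓B-lower n (suc k) {v} v≤b b≤v = begin
      S + b + v                              ≡⟨ solve 3 (λ S b v → S :+ b :+ v := S :+ v :+ b) refl S b v ⟩
      S + v + b                              ≤⟨ +-monoˡ-≤ b (+-mono-≤
                                                  (∑[1⋯]-mono k λ j j≤k → ⊓-glb (b≤v j (ℕ.s≤s j≤k)) ≤-refl)
                                                  (⊓-glb ≤-refl v≤b)) ⟩
      ∑[1⋯ k ] (λ j → v ⊓ B n j) + v ⊓ b + b ∎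
      where
      open ≤-Reasoning
      S = ∑[1⋯ k ] (B n)
      b = B n (suc k)

  -- The induction step: fibre weights `w` against a shadow of weight `D`

  module _ {A : Set} (xs : List A) (w : A → ℚ) (q m : ℕ) .{{_ : Positive (fromNat q)}} {D : ℚ}
           (0≤w : ∀ x → 0ℚ ≤ w x) (w≤D : ∀ x → w x ≤ D)
           (IH : ∑ xs (λ x → ∑[1⋯ suc m ] (λ j → w x ⊓ B q (suc m) j)) ≤ fromNat (suc m) * fromNat q * D)
    where
    private
      M N Q w₀ ŵ : ℚ
      M = fromNat (suc m)
      N = fromNat (suc (suc m))
      Q = fromNat q
      w₀ = ∑ xs w
      b b′ : ℕ → ℚ
      b  = B q (suc m)
      b′ = B q (suc (suc m))
      -- No threshold in the bound exceeds `b′ (suc (suc m))`, so weight above it can be cut off,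
      -- and `ŵ` falls into some bracket.
      ŵ = w₀ ⊓ b′ (suc (suc m))

      instance
        MQ-pos : Positive (M * Q)
        MQ-pos = pos*pos⇒pos M {{fromNat-pos m}} Q
        NQ-pos : Positive (N * Q)
        NQ-pos = pos*pos⇒pos N {{fromNat-pos (suc m)}} Q
        NQ-nonZero : NonZero (N * Q)
        NQ-nonZero = pos⇒nonZero (N * Q)

    -- The ball of weight ŵ has fibres of weight W over each of the first q letters and V over the
    -- last one; both are read off from N Q W = ∑ⱼ min(ŵ, b′ⱼ) and ŵ = Q W + V.
    module _ (k : ℕ) (k≤m : k ℕ.≤ suc m) (b′≤ŵ : b′ k ≤ ŵ) (ŵ≤b′ : ŵ ≤ b′ (suc k)) where
      private
        K S T W V : ℚ
        K = fromNat k
        S = ∑[1⋯ k ] b′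
        T = ∑[1⋯ k ] b
        W = 1/ (N * Q) * (S + (N - K) * ŵ)
        V = ŵ - Q * W

        NQW : N * Q * W ≡ S + (N - K) * ŵ
        NQW = begin
          N * Q * (1/ (N * Q) * (S + (N - K) * ŵ))   ≡⟨ *-assoc (N * Q) (1/ (N * Q)) _ ⟨
          N * Q * 1/ (N * Q) * (S + (N - K) * ŵ)     ≡⟨ cong (_* (S + (N - K) * ŵ)) (*-inverseʳ (N * Q)) ⟩
          1ℚ * (S + (N - K) * ŵ)                     ≡⟨ *-identityˡ _ ⟩
          S + (N - K) * ŵ                            ∎
          where open ≡-Reasoning

        NV : N * V ≡ K * ŵ - S
        NV = begin
          N * (ŵ - Q * W)
            ≡⟨ solve 4 (λ N Q W w → N :* (w :- Q :* W) := N :* w :- N :* Q :* W) refl N Q W ŵ ⟩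
          N * ŵ - N * Q * W                ≡⟨ cong (λ z → N * ŵ - z) NQW ⟩
          N * ŵ - (S + (N - K) * ŵ)
            ≡⟨ solve 4 (λ N K S w → N :* w :- (S :+ (N :- K) :* w) := K :* w :- S) refl N K S ŵ ⟩
          K * ŵ - S                        ∎
          where open ≡-Reasoning

        K≤N : K ≤ N
        K≤N = fromNat-mono (ℕ.m≤n⇒m≤1+n k≤m)

        -- On the bracket `W` is affine in `ŵ`, and `∑B` gives its values at the two ends as `b k`
        -- and `b (suc k)`. The bounds on `V` arise in the same way, with `b (k - 1)` and `b k` at
        -- the ends.
        b≤W : b k ≤ W
        b≤W = *-cancelˡ-≤-pos (N * Q) (begin
          N * Q * b k              ≡⟨ ∑B q (suc m) k ⟩
          S + (N - K) * b′ k       ≤⟨ +-monoʳ-≤ S (*-monoˡ (0≤-diff K≤N) b′≤ŵ) ⟩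
          S + (N - K) * ŵ          ≡⟨ NQW ⟨
          N * Q * W                ∎)
          where open ≤-Reasoning

        W≤b : W ≤ b (suc k)
        W≤b = *-cancelˡ-≤-pos (N * Q) (begin
          N * Q * W                                      ≡⟨ NQW ⟩
          S + (N - K) * ŵ                                ≤⟨ +-monoʳ-≤ S (*-monoˡ (0≤-diff K≤N) ŵ≤b′) ⟩
          S + (N - K) * b′ (suc k)
            ≡⟨ solve 4 (λ S N K b → S :+ (N :- K) :* b := S :+ b :+ (N :- (con 1ℚ :+ K)) :* b) refl S N K (b′ (suc k)) ⟩
          S + b′ (suc k) + (N - (1ℚ + K)) * b′ (suc k)   ≡⟨ ∑B q (suc m) (suc k) ⟨
          N * Q * b (suc k)                              ∎)
          where open ≤-Reasoning

        V≤b : V ≤ b k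
        V≤b = *-cancelˡ-≤-pos N {{fromNat-pos (suc m)}} (begin
          N * V                                          ≡⟨ NV ⟩
          K * ŵ - S                                      ≤⟨ +-monoˡ-≤ (- S) (*-monoˡ (0≤fromNat k) ŵ≤b′) ⟩
          K * b′ (suc k) - S
            ≡⟨ solve 4 (λ S N K b → K :* b :- S := N :* b :- (S :+ b :+ (N :- (con 1ℚ :+ K)) :* b)) refl S N K (b′ (suc k)) ⟩
          N * b′ (suc k) - (S + b′ (suc k) + (N - (1ℚ + K)) * b′ (suc k))
                                                         ≡⟨ cong (λ z → N * b′ (suc k) - z) (∑B q (suc m) (suc k)) ⟨
          N * (Q * b (suc k) + b k) - N * Q * b (suc k)
            ≡⟨ solve 4 (λ N Q a b → N :* (Q :* a :+ b) :- N :* Q :* a := N :* b) refl N Q (b (suc k)) (b k) ⟩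
          N * b k                                        ∎)
          where open ≤-Reasoning

        b≤V : ∀ j → j ℕ.< k → b j ≤ V
        b≤V j j<k = ≤-trans (B-pascal-≥ q (suc m) j<k) (*-cancelˡ-≤-pos N {{fromNat-pos (suc m)}} (begin
          N * (b′ k - Q * b k)
            ≡⟨ solve 4 (λ N Q c b → N :* (c :- Q :* b) := N :* c :- N :* Q :* b) refl N Q (b′ k) (b k) ⟩
          N * b′ k - N * Q * b k                    ≡⟨ cong (λ z → N * b′ k - z) (∑B q (suc m) k) ⟩
          N * b′ k - (S + (N - K) * b′ k)
            ≡⟨ solve 4 (λ N K S b → N :* b :- (S :+ (N :- K) :* b) := K :* b :- S) refl N K S (b′ k) ⟩
          K * b′ k - S                              ≤⟨ +-monoˡ-≤ (- S) (*-monoˡ (0≤fromNat k) b′≤ŵ) ⟩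
          K * ŵ - S                                 ≡⟨ NV ⟨
          N * V                                     ∎))
          where open ≤-Reasoning

        -- If `D ≤ W`, no fibre exceeds `W`, while the fibres sum to at least `Q * W + V`. Karamata
        -- then applies with threshold `b j`, which is at most `b k` and hence at most `W`.
        fibre-lower : D ≤ W → ∀ j → j ℕ.≤ k → Q * b j + V ⊓ b j ≤ ∑ xs (λ x → w x ⊓ b j)
        fibre-lower D≤W j j≤k = ∑-⊓-lower xs w q V (0≤B q (suc m) j) (≤-trans (B-mono q (suc m) j≤k) b≤W) 0≤w
          (λ x → ≤-trans (w≤D x) D≤W) (begin
            Q * W + (ŵ - Q * W)    ≡⟨ solve 2 (λ a w → a :+ (w :- a) := w) refl (Q * W) ŵ ⟩
            ŵ                      ≤⟨ p⊓q≤p w₀ (b′ (suc (suc m))) ⟩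
            w₀                     ∎)
          where open ≤-Reasoning

        -- Beyond `k` the threshold is at least `W`, so truncation leaves every fibre intact and the
        -- whole weight is counted.
        fibre-upper : D ≤ W → ∀ j → k ℕ.< j → ŵ ≤ ∑ xs (λ x → w x ⊓ b j)
        fibre-upper D≤W j k<j = ≤-trans (p⊓q≤p w₀ (b′ (suc (suc m)))) (∑-mono xs λ x →
          ⊓-glb ≤-refl (≤-trans (w≤D x) (≤-trans D≤W (≤-trans W≤b (B-mono q (suc m) k<j)))))

        -- `M * Q * W` is bounded by the inductive bounds for the fibres of the ball:
        -- `Q * b j + V ⊓ b j` for `j` up to `k`, and `ŵ` for each later `j`. The two preceding
        -- bounds pass to the fibres of the family, where `IH` applies.
        MQW≤ : D ≤ W → M * Q * W ≤ M * Q * D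
        MQW≤ D≤W = begin
          M * Q * W
            ≡⟨ solve 3 (λ M Q W → M :* Q :* W := (con 1ℚ :+ M) :* Q :* W :- Q :* W) refl M Q W ⟩
          N * Q * W - Q * W
            ≡⟨ cong (_- Q * W) NQW ⟩
          S + (N - K) * ŵ - Q * W
            ≡⟨ solve 6 (λ S M K w a b → S :+ ((con 1ℚ :+ M) :- K) :* w :- a := (S :+ b) :- b :+ (w :- a) :+ (M :- K) :* w)
                 refl S M K ŵ (Q * W) (b k) ⟩
          (S + b k) - b k + V + (M - K) * ŵ
            ≡⟨ cong (λ z → z - b k + V + (M - K) * ŵ) (∑B-pascal q (suc m) k) ⟩
          (1ℚ + Q) * T - b k + V + (M - K) * ŵ
            ≡⟨ solve 5 (λ Q T b v e → (con 1ℚ :+ Q) :* T :- b :+ v :+ e := (Q :* T :+ (T :+ v) :- b) :+ e)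
                 refl Q T (b k) V ((M - K) * ŵ) ⟩
          (Q * T + (T + V) - b k) + (M - K) * ŵ
            ≤⟨ +-monoˡ-≤ ((M - K) * ŵ) (+-monoˡ-≤ (- b k) (+-monoʳ-≤ (Q * T) (∑⊓B-lower q (suc m) k V≤b b≤V))) ⟩
          (Q * T + (∑[1⋯ k ] (λ j → V ⊓ b j) + b k) - b k) + (M - K) * ŵ
            ≡⟨ solve 4 (λ a s b e → (a :+ (s :+ b) :- b) :+ e := (a :+ s) :+ e)
                 refl (Q * T) (∑[1⋯ k ] (λ j → V ⊓ b j)) (b k) ((M - K) * ŵ) ⟩
          (Q * T + ∑[1⋯ k ] (λ j → V ⊓ b j)) + (M - K) * ŵ
            ≡⟨ cong (λ z → z + ∑[1⋯ k ] (λ j → V ⊓ b j) + (M - K) * ŵ) (∑[1⋯]-*ˡ k Q b) ⟨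
          (∑[1⋯ k ] (λ j → Q * b j) + ∑[1⋯ k ] (λ j → V ⊓ b j)) + (M - K) * ŵ
            ≡⟨ cong (_+ (M - K) * ŵ) (∑[1⋯]-+ k (λ j → Q * b j) (λ j → V ⊓ b j)) ⟨
          ∑[1⋯ k ] (λ j → Q * b j + V ⊓ b j) + (M - K) * ŵ
            ≤⟨ +-monoˡ-≤ ((M - K) * ŵ) (∑[1⋯]-mono k (fibre-lower D≤W)) ⟩
          ∑[1⋯ k ] (λ j → ∑ xs (λ x → w x ⊓ b j)) + (M - K) * ŵ
            ≤⟨ ∑[1⋯]-tail-≥ k≤m (fibre-upper D≤W) ⟩
          ∑[1⋯ suc m ] (λ j → ∑ xs (λ x → w x ⊓ b j))
            ≡⟨ ∑-swap xs (suc m) (λ x j → w x ⊓ b j) ⟨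
          ∑ xs (λ x → ∑[1⋯ suc m ] (λ j → w x ⊓ b j))
            ≤⟨ IH ⟩
          M * Q * D ∎
          where open ≤-Reasoning

        W≤D : W ≤ D
        W≤D with ≤-total W D
        ... | inj₁ W≤D = W≤D
        ... | inj₂ D≤W = *-cancelˡ-≤-pos (M * Q) (MQW≤ D≤W)

      step-within : ∑[1⋯ suc (suc m) ] (λ j → w₀ ⊓ b′ j) ≤ N * Q * D
      step-within = begin
        ∑[1⋯ suc (suc m) ] (λ j → w₀ ⊓ b′ j)
          -- Terms beyond `k` are at most `ŵ` and the others at most `b′ j`, which is the expression
          -- that defines `W`.
          ≤⟨ ∑[1⋯]-tail-≤ (ℕ.m≤n⇒m≤1+n k≤m) (λ j _ j≤n → ⊓-monoʳ-≤ w₀ (B-mono q (suc (suc m)) j≤n)) ⟩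
        ∑[1⋯ k ] (λ j → w₀ ⊓ b′ j) + (N - K) * ŵ
          ≤⟨ +-monoˡ-≤ ((N - K) * ŵ) (∑[1⋯]-mono k (λ j _ → p⊓q≤q w₀ (b′ j))) ⟩
        S + (N - K) * ŵ
          ≡⟨ NQW ⟨
        N * Q * W
          ≤⟨ *-monoˡ (<⇒≤ (positive⁻¹ (N * Q))) W≤D ⟩
        N * Q * D ∎
        where open ≤-Reasoning

    step : ∑[1⋯ suc (suc m) ] (λ j → w₀ ⊓ b′ j) ≤ N * Q * D
    step with bracket b′ (suc m) (⊓-glb (∑-nonneg xs 0≤w) (0≤B q (suc (suc m)) (suc (suc m)))) (p⊓q≤q w₀ (b′ (suc (suc m))))
    ... | k , k≤m , b′≤ŵ , ŵ≤b′ = step-within k k≤m b′≤ŵ ŵ≤b′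

  -- Sums over words and induction on the length

  ∑-++ : ∀ {A : Set} (xs ys : List A) g → ∑ (xs ++ ys) g ≡ ∑ xs g + ∑ ys g
  ∑-++ []       ys g = sym (+-identityˡ _)
  ∑-++ (x ∷ xs) ys g rewrite ∑-++ xs ys g = sym (+-assoc (g x) (∑ xs g) (∑ ys g))

  ∑-map : ∀ {A B : Set} (f : A → B) xs g → ∑ (map f xs) g ≡ ∑ xs (g ∘ f)
  ∑-map f []       g = refl
  ∑-map f (x ∷ xs) g = cong (g (f x) +_) (∑-map f xs g)

  ∑-cartesianProductWith : ∀ {A B C : Set} (f : A → B → C) xs ys g →
    ∑ (cartesianProductWith f xs ys) g ≡ ∑ xs (λ x → ∑ ys (λ y → g (f x y)))
  ∑-cartesianProductWith f []       ys g = refl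
  ∑-cartesianProductWith f (x ∷ xs) ys g =
    trans (∑-++ (map (f x) ys) (cartesianProductWith f xs ys) g)
          (cong₂ _+_ (∑-map (f x) ys g) (∑-cartesianProductWith f xs ys g))

  ∑-allFin : ∀ r (g : Fin (suc r) → ℚ) → ∑ (allFin (suc r)) g ≡ g zero + ∑ (allFin r) (g ∘ suc)
  ∑-allFin r g = cong (λ xs → g zero + foldr _+_ 0ℚ xs) (trans (map-tabulate suc g) (sym (map-tabulate id (g ∘ suc))))

  ∑-words : ∀ r n (F : Word r (suc n) → ℚ) →
            ∑ (words r (suc n)) F ≡ ∑ (allFin r) (λ y → ∑ (words r n) (λ w → F (y ∷ w)))
  ∑-words r n F = ∑-cartesianProductWith _∷_ (allFin r) (words r n) F

  ∈-words : ∀ {r n} (w : Word r n) → w ∈ words r n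
  ∈-words []      = here refl
  ∈-words (y ∷ w) = ∈-cartesianProductWith⁺ _∷_ (∈-allFin y) (∈-words w)

  ∑-threshold : ∀ {r} (s : Fin r) (g : Fin r → ℚ) {a b} →
    (∀ y → y Fin.< s → g y ≡ a) → g s ≡ b → (∀ y → s Fin.< y → g y ≡ 0ℚ) →
    ∑ (allFin r) g ≡ fromNat (toℕ s) * a + b
  ∑-threshold {suc r} zero g {a} {b} <s ≡s >s = begin
    ∑ (allFin (suc r)) g                ≡⟨ ∑-allFin r g ⟩
    g zero + ∑ (allFin r) (g ∘ suc)
      ≡⟨ cong₂ _+_ ≡s (trans (∑-cong (allFin r) (λ y → >s (suc y) ℕ.z<s)) (∑-0 (allFin r))) ⟩
    b + 0ℚ                              ≡⟨ solve 2 (λ a b → b :+ con 0ℚ := con 0ℚ :* a :+ b) refl a b ⟩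
    0ℚ * a + b                          ∎
    where open ≡-Reasoning
  ∑-threshold {suc r} (suc s) g {a} {b} <s ≡s >s = begin
    ∑ (allFin (suc r)) g                ≡⟨ ∑-allFin r g ⟩
    g zero + ∑ (allFin r) (g ∘ suc)
      ≡⟨ cong₂ _+_ (<s zero ℕ.z<s) (∑-threshold s (g ∘ suc) (λ y y<s → <s (suc y) (ℕ.s<s y<s)) ≡s (λ y s<y → >s (suc y) (ℕ.s<s s<y))) ⟩
    a + (fromNat (toℕ s) * a + b)
      ≡⟨ solve 3 (λ s a b → a :+ (s :* a :+ b) := (con 1ℚ :+ s) :* a :+ b) refl (fromNat (toℕ s)) a b ⟩
    (1ℚ + fromNat (toℕ s)) * a + b      ∎
    where open ≡-Reasoning

  module _ {r : ℕ} where

    -- Induction by splitting off the first letter. `G` is any majorant of the insertions rather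
    -- than the shadow itself, so it restricts to fibres and can absorb approximation errors. The
    -- hypothesis on the last position survives every split down to length 1, where it is the claim.
    shadow-weight : ∀ q → .{{_ : Positive (fromNat q)}} → ∀ m (F : Word r (suc m) → ℚ) (G : Word r m → ℚ) →
      (∀ w → 0ℚ ≤ F w) → (∀ x i y → F (insertAt x i y) ≤ G x) →
      (∀ x → ∑ (allFin r) (λ y → F (insertAt x (Fin.fromℕ m) y)) ⊓ fromNat q ≤ fromNat q * G x) →
      ∑[1⋯ suc m ] (λ j → ∑ (words r (suc m)) F ⊓ B q (suc m) j) ≤ fromNat (suc m) * fromNat q * ∑ (words r m) G
    shadow-weight q zero F G 0≤F F≤G fibre = begin
      0ℚ + ∑ (words r 1) F ⊓ (fromNat q * 1ℚ + 0ℚ)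
        ≡⟨ cong₂ (λ a b → 0ℚ + a ⊓ b)
             (trans (∑-words r 0 F) (∑-cong (allFin r) (λ y → +-identityʳ (F (y ∷ [])))))
             (solve 1 (λ q → q :* con 1ℚ :+ con 0ℚ := q) refl (fromNat q)) ⟩
      0ℚ + ∑ (allFin r) (λ y → F (y ∷ [])) ⊓ fromNat q
        ≡⟨ +-identityˡ _ ⟩
      ∑ (allFin r) (λ y → F (y ∷ [])) ⊓ fromNat q
        ≤⟨ fibre [] ⟩
      fromNat q * G []
        ≡⟨ solve 2 (λ q g → q :* g := (con 1ℚ :+ con 0ℚ) :* q :* (g :+ con 0ℚ)) refl (fromNat q) (G []) ⟩
      (1ℚ + 0ℚ) * fromNat q * (G [] + 0ℚ) ∎
      where open ≤-Reasoning
    shadow-weight q (suc m) F G 0≤F F≤G fibre = begin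
      ∑[1⋯ suc (suc m) ] (λ j → ∑ (words r (suc (suc m))) F ⊓ B q (suc (suc m)) j)
        ≡⟨ cong (λ z → ∑[1⋯ suc (suc m) ] (λ j → z ⊓ B q (suc (suc m)) j)) (∑-words r (suc m) F) ⟩
      ∑[1⋯ suc (suc m) ] (λ j → ∑ (allFin r) weight ⊓ B q (suc (suc m)) j)
        ≤⟨ step (allFin r) weight q m (λ y → ∑-nonneg (words r (suc m)) (λ w → 0≤F (y ∷ w)))
             (λ y → ∑-mono (words r (suc m)) (λ w → F≤G w zero y)) (begin
          ∑ (allFin r) (λ y → ∑[1⋯ suc m ] (λ j → weight y ⊓ B q (suc m) j))
            ≤⟨ ∑-mono (allFin r) (λ y → shadow-weight q m (λ w → F (y ∷ w)) (λ x → G (y ∷ x))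
                 (λ w → 0≤F (y ∷ w)) (λ x i → F≤G (y ∷ x) (suc i)) (λ x → fibre (y ∷ x))) ⟩
          ∑ (allFin r) (λ y → fromNat (suc m) * fromNat q * ∑ (words r m) (λ x → G (y ∷ x)))
            ≡⟨ ∑-*ˡ (allFin r) (fromNat (suc m) * fromNat q) _ ⟩
          fromNat (suc m) * fromNat q * ∑ (allFin r) (λ y → ∑ (words r m) (λ x → G (y ∷ x)))
            ≡⟨ cong (fromNat (suc m) * fromNat q *_) (∑-words r m G) ⟨
          fromNat (suc m) * fromNat q * ∑ (words r (suc m)) G ∎) ⟩
      fromNat (suc (suc m)) * fromNat q * ∑ (words r (suc m)) G ∎
      where
      open ≤-Reasoning
      weight : Fin r → ℚ
      weight y = ∑ (words r (suc m)) (λ w → F (y ∷ w))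

    -- The counterpart of `shadow-weight` for `q = 0`: the lines in the last coordinate partition
    -- the words, so bounding each line suffices.
    ∑-words-fibres : ∀ m (F : Word r (suc m) → ℚ) (G : Word r m → ℚ) →
      (∀ x → ∑ (allFin r) (λ y → F (insertAt x (Fin.fromℕ m) y)) ≤ G x) →
      ∑ (words r (suc m)) F ≤ ∑ (words r m) G
    ∑-words-fibres zero F G fibre = begin
      ∑ (words r 1) F
        ≡⟨ trans (∑-words r 0 F) (∑-cong (allFin r) (λ y → +-identityʳ (F (y ∷ [])))) ⟩
      ∑ (allFin r) (λ y → F (y ∷ []))         ≤⟨ fibre [] ⟩
      G []                                    ≡⟨ +-identityʳ (G []) ⟨
      G [] + 0ℚ                               ∎
      where open ≤-Reasoning
    ∑-words-fibres (suc m) F G fibre = begin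
      ∑ (words r (suc (suc m))) F                                   ≡⟨ ∑-words r (suc m) F ⟩
      ∑ (allFin r) (λ y → ∑ (words r (suc m)) (λ w → F (y ∷ w)))
        ≤⟨ ∑-mono (allFin r) (λ y → ∑-words-fibres m _ _ (λ x → fibre (y ∷ x))) ⟩
      ∑ (allFin r) (λ y → ∑ (words r m) (λ x → G (y ∷ x)))          ≡⟨ ∑-words r m G ⟨
      ∑ (words r (suc m)) G                                         ∎
      where open ≤-Reasoning

    ∑-fibre-≤ : ∀ m (F : Word r (suc m) → ℚ) → (∀ w → 0ℚ ≤ F w) → ∀ x →
      ∑ (allFin r) (λ y → F (insertAt x (Fin.fromℕ m) y)) ≤ ∑ (words r (suc m)) F
    ∑-fibre-≤ zero    F 0≤F []      = ≤-reflexive (sym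
      (trans (∑-words r 0 F) (∑-cong (allFin r) (λ y → +-identityʳ (F (y ∷ []))))))
    ∑-fibre-≤ (suc m) F 0≤F (z ∷ x) = begin
      ∑ (allFin r) (λ y → F (z ∷ insertAt x (Fin.fromℕ m) y))
        ≤⟨ ∑-fibre-≤ m (λ w → F (z ∷ w)) (λ w → 0≤F (z ∷ w)) x ⟩
      ∑ (words r (suc m)) (λ w → F (z ∷ w))
        ≤⟨ ∑-∈ (λ y → ∑-nonneg (words r (suc m)) (λ w → 0≤F (y ∷ w))) (∈-allFin z) ⟩
      ∑ (allFin r) (λ y → ∑ (words r (suc m)) (λ w → F (y ∷ w)))    ≡⟨ ∑-words r (suc m) F ⟨
      ∑ (words r (suc (suc m))) F                                   ∎
      where open ≤-Reasoning

  -- Balls as combinations of indicators, and their shadows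

  below : ℕ → ℕ → ℚ
  below zero    j       = 0ℚ
  below (suc k) zero    = 1ℚ
  below (suc k) (suc j) = below k j

  below-< : ∀ {j k} → j ℕ.< k → below k j ≡ 1ℚ
  below-< {zero}  {suc k} j<k         = refl
  below-< {suc j} {suc k} (ℕ.s≤s j<k) = below-< j<k

  below-≥ : ∀ {j k} → k ℕ.≤ j → below k j ≡ 0ℚ
  below-≥ {j}     {zero}  k≤j         = refl
  below-≥ {suc j} {suc k} (ℕ.s≤s k≤j) = below-≥ k≤j

  below-step : ∀ k j → below k j ≤ below (suc k) j
  below-step zero    zero    = 0≤1ℚ
  below-step zero    (suc j) = ≤-refl
  below-step (suc k) zero    = ≤-refl
  below-step (suc k) (suc j) = below-step k j

  0≤below : ∀ k j → 0ℚ ≤ below k j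
  0≤below zero    j       = ≤-refl
  0≤below (suc k) zero    = 0≤1ℚ
  0≤below (suc k) (suc j) = 0≤below k j

  below≤1 : ∀ k j → below k j ≤ 1ℚ
  below≤1 zero    j       = 0≤1ℚ
  below≤1 (suc k) zero    = ≤-refl
  below≤1 (suc k) (suc j) = below≤1 k j

  module _ {r : ℕ} (s : Fin r) where

    -- The indicator of an integral ball, with the index shifted as in `B`: `inside 0` is the empty
    -- ball.
    inside : ∀ {n} → ℕ → Word r n → ℚ
    inside k w = if does (all? (Fin._≤? s) w) then below k (count (Fin._≟ s) w) else 0ℚ

    inside-zero : ∀ {n} (w : Word r n) → inside 0 w ≡ 0ℚ
    inside-zero w with does (all? (Fin._≤? s) w)
    ... | false = refl
    ... | true  = refl

    inside-< : ∀ {n} k {y} → y Fin.< s → (w : Word r n) → inside k (y ∷ w) ≡ inside k w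
    inside-< k {y} y<s w rewrite dec-true (y Fin.≤? s) (ℕ.<⇒≤ y<s) | dec-false (y Fin.≟ s) (Fin.<⇒≢ y<s) = refl

    inside-≡ : ∀ {n} k (w : Word r n) → inside (suc k) (s ∷ w) ≡ inside k w
    inside-≡ k w rewrite dec-true (s Fin.≤? s) ℕ.≤-refl | dec-true (s Fin.≟ s) refl = refl

    inside-> : ∀ {n} k {y} → s Fin.< y → (w : Word r n) → inside k (y ∷ w) ≡ 0ℚ
    inside-> k {y} s<y w rewrite dec-false (y Fin.≤? s) (ℕ.<⇒≱ s<y) = refl

    inside-step : ∀ {n} k (w : Word r n) → inside k w ≤ inside (suc k) w
    inside-step k w with does (all? (Fin._≤? s) w)
    ... | false = ≤-refl
    ... | true  = below-step k (count (Fin._≟ s) w)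

    0≤inside : ∀ {n} k (w : Word r n) → 0ℚ ≤ inside k w
    0≤inside k w with does (all? (Fin._≤? s) w)
    ... | false = ≤-refl
    ... | true  = 0≤below k (count (Fin._≟ s) w)

    inside≤1 : ∀ {n} k (w : Word r n) → inside k w ≤ 1ℚ
    inside≤1 k w with does (all? (Fin._≤? s) w)
    ... | false = 0≤1ℚ
    ... | true  = below≤1 k (count (Fin._≟ s) w)

    inside-∷ : ∀ {n} k y (w : Word r n) → inside k (y ∷ w) ≤ inside k w
    inside-∷ zero y w = ≤-reflexive (trans (inside-zero (y ∷ w)) (sym (inside-zero w)))
    inside-∷ (suc k) y w with Fin.<-cmp y s
    ... | tri< y<s _ _  = ≤-reflexive (inside-< (suc k) y<s w)
    ... | tri≈ _ refl _ = ≤-trans (≤-reflexive (inside-≡ k w)) (inside-step k w)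
    ... | tri> _ _ s<y  = ≤-trans (≤-reflexive (inside-> (suc k) s<y w)) (0≤inside (suc k) w)

    -- The hypothesis ranges over all `k` because prepending `s` passes from `suc k` to `k`.
    inside-∷-mono : ∀ {n m} z (w : Word r n) (x : Word r m) →
      (∀ k → inside k w ≤ inside k x) → ∀ k → inside k (z ∷ w) ≤ inside k (z ∷ x)
    inside-∷-mono z w x w≤x zero = ≤-reflexive (trans (inside-zero (z ∷ w)) (sym (inside-zero (z ∷ x))))
    inside-∷-mono z w x w≤x (suc k) with Fin.<-cmp z s
    ... | tri< z<s _ _  rewrite inside-< (suc k) z<s w | inside-< (suc k) z<s x = w≤x (suc k)
    ... | tri≈ _ refl _ rewrite inside-≡ k w | inside-≡ k x = w≤x k
    ... | tri> _ _ s<z  rewrite inside-> (suc k) s<z w | inside-> (suc k) s<z x = ≤-refl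

    -- Deleting a letter creates neither a letter above `s` nor a further copy of `s`, so the shadow
    -- of a ball lies in the ball of the same index.
    inside-insertAt : ∀ {n} (x : Word r n) i y k → inside k (insertAt x i y) ≤ inside k x
    inside-insertAt x       zero    y k = inside-∷ k y x
    inside-insertAt (z ∷ x) (suc i) y k = inside-∷-mono z (insertAt x i y) x (inside-insertAt x i y) k

    ∑-inside : ∀ n k → ∑ (words r n) (inside k) ≡ B (toℕ s) n k
    ∑-inside n       zero    = trans (∑-cong (words r n) inside-zero) (∑-0 (words r n))
    ∑-inside zero    (suc k) = +-identityʳ 1ℚ
    ∑-inside (suc n) (suc k) = begin
      ∑ (words r (suc n)) (inside (suc k))
        ≡⟨ ∑-words r n (inside (suc k)) ⟩
      ∑ (allFin r) (λ y → ∑ (words r n) (λ w → inside (suc k) (y ∷ w)))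
        ≡⟨ ∑-threshold s _
             (λ y y<s → trans (∑-cong (words r n) (inside-< (suc k) y<s)) (∑-inside n (suc k)))
             (trans (∑-cong (words r n) (inside-≡ k)) (∑-inside n k))
             (λ y s<y → trans (∑-cong (words r n) (inside-> (suc k) s<y)) (∑-0 (words r n))) ⟩
      fromNat (toℕ s) * B (toℕ s) n (suc k) + B (toℕ s) n k ∎
      where open ≡-Reasoning

    -- The fractional ball as a combination of two consecutive integral balls, convex for `a` in the
    -- unit interval. At most `k` copies means fewer than `k + 1`, whence the first index.
    ballℚ : ∀ {n} → ℕ → ℚ → Word r n → ℚ
    ballℚ k a w = (1ℚ - a) * inside (suc k) w + a * inside (suc (suc k)) w

    ∑-ballℚ : ∀ n k a → ∑ (words r n) (ballℚ k a) ≡ (1ℚ - a) * B (toℕ s) n (suc k) + a * B (toℕ s) n (suc (suc k))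
    ∑-ballℚ n k a = begin
      ∑ (words r n) (ballℚ k a)
        ≡⟨ ∑-+ (words r n) _ _ ⟩
      ∑ (words r n) (λ w → (1ℚ - a) * inside (suc k) w) + ∑ (words r n) (λ w → a * inside (suc (suc k)) w)
        ≡⟨ cong₂ _+_ (∑-*ˡ (words r n) (1ℚ - a) _) (∑-*ˡ (words r n) a _) ⟩
      (1ℚ - a) * ∑ (words r n) (inside (suc k)) + a * ∑ (words r n) (inside (suc (suc k)))
        ≡⟨ cong₂ (λ u v → (1ℚ - a) * u + a * v) (∑-inside n (suc k)) (∑-inside n (suc (suc k))) ⟩
      (1ℚ - a) * B (toℕ s) n (suc k) + a * B (toℕ s) n (suc (suc k)) ∎
      where open ≡-Reasoning

    -- The derivative in `a` is the indicator of the words over `[s]` with exactly `k + 1` copies of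
    -- `s`, which lies between 0 and 1.
    ballℚ-insensitive : ∀ {n} k {a a′ δ} → 0ℚ ≤ δ → a ≤ a′ + δ → (w : Word r n) → ballℚ k a w ≤ ballℚ k a′ w + δ
    ballℚ-insensitive k {a} {a′} {δ} 0≤δ a≤a′+δ w = ≤-by
      (0≤-+ (0≤-* (0≤-diff a≤a′+δ) (0≤-diff (inside-step (suc k) w)))
            (0≤-* 0≤δ (0≤-+ (0≤-diff (inside≤1 (suc (suc k)) w)) (0≤inside (suc k) w))))
      (solve 5 (λ a a′ d u v → ((con 1ℚ :- a) :* u :+ a :* v) :+ ((a′ :+ d :- a) :* (v :- u) :+ d :* (con 1ℚ :- v :+ u))
         := ((con 1ℚ :- a′) :* u :+ a′ :* v) :+ d) refl a a′ δ (inside (suc k) w) (inside (suc (suc k)) w))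

    module _ {k : ℕ} {a : ℚ} (0≤a : 0ℚ ≤ a) (a≤1 : a ≤ 1ℚ) where

      ballℚ-mono : ∀ {n m} (w : Word r n) (x : Word r m) → (∀ k → inside k w ≤ inside k x) → ballℚ k a w ≤ ballℚ k a x
      ballℚ-mono w x w≤x = +-mono-≤ (*-monoˡ (0≤-diff a≤1) (w≤x (suc k))) (*-monoˡ 0≤a (w≤x (suc (suc k))))

      0≤ballℚ : ∀ {n} (w : Word r n) → 0ℚ ≤ ballℚ k a w
      0≤ballℚ w = 0≤-+ (0≤-* (0≤-diff a≤1) (0≤inside (suc k) w)) (0≤-* 0≤a (0≤inside (suc (suc k)) w))

      -- Both integral balls satisfy `∑B-min`, and the right side is concave in the weight because
      -- each minimum is.
      ∑-ballℚ-upper : ∀ m → fromNat (suc m) * fromNat (toℕ s) * ∑ (words r m) (ballℚ k a)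
                          ≤ ∑[1⋯ suc m ] (λ j → ∑ (words r (suc m)) (ballℚ k a) ⊓ B (toℕ s) (suc m) j)
      ∑-ballℚ-upper m = begin
        NQ * ∑ (words r m) (ballℚ k a)
          ≡⟨ cong (NQ *_) (∑-ballℚ m k a) ⟩
        NQ * ((1ℚ - a) * B q m (suc k) + a * B q m (suc (suc k)))
          ≡⟨ solve 4 (λ N a u v → N :* ((con 1ℚ :- a) :* u :+ a :* v) := (con 1ℚ :- a) :* (N :* u) :+ a :* (N :* v)) refl
               NQ a (B q m (suc k)) (B q m (suc (suc k))) ⟩
        (1ℚ - a) * (NQ * B q m (suc k)) + a * (NQ * B q m (suc (suc k)))
          ≤⟨ +-mono-≤ (*-monoˡ (0≤-diff a≤1) (∑B-min q m (suc k))) (*-monoˡ 0≤a (∑B-min q m (suc (suc k)))) ⟩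
        (1ℚ - a) * ∑[1⋯ suc m ] (λ j → b (suc k) ⊓ b j) + a * ∑[1⋯ suc m ] (λ j → b (suc (suc k)) ⊓ b j)
          ≡⟨ cong₂ _+_ (∑[1⋯]-*ˡ (suc m) (1ℚ - a) _) (∑[1⋯]-*ˡ (suc m) a _) ⟨
        ∑[1⋯ suc m ] (λ j → (1ℚ - a) * (b (suc k) ⊓ b j)) + ∑[1⋯ suc m ] (λ j → a * (b (suc (suc k)) ⊓ b j))
          ≡⟨ ∑[1⋯]-+ (suc m) _ _ ⟨
        ∑[1⋯ suc m ] (λ j → (1ℚ - a) * (b (suc k) ⊓ b j) + a * (b (suc (suc k)) ⊓ b j))
          ≤⟨ ∑[1⋯]-mono (suc m) (λ j _ → ⊓-glb
               (+-mono-≤ (*-monoˡ (0≤-diff a≤1) (p⊓q≤p (b (suc k)) (b j))) (*-monoˡ 0≤a (p⊓q≤p (b (suc (suc k))) (b j))))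
               (≤-trans (+-mono-≤ (*-monoˡ (0≤-diff a≤1) (p⊓q≤q (b (suc k)) (b j))) (*-monoˡ 0≤a (p⊓q≤q (b (suc (suc k))) (b j))))
                 (≤-reflexive (solve 2 (λ a x → (con 1ℚ :- a) :* x :+ a :* x := x) refl a (b j))))) ⟩
        ∑[1⋯ suc m ] (λ j → ((1ℚ - a) * b (suc k) + a * b (suc (suc k))) ⊓ b j)
          ≡⟨ cong (λ z → ∑[1⋯ suc m ] (λ j → z ⊓ b j)) (∑-ballℚ (suc m) k a) ⟨
        ∑[1⋯ suc m ] (λ j → ∑ (words r (suc m)) (ballℚ k a) ⊓ b j) ∎
        where
        open ≤-Reasoning
        q = toℕ s
        NQ = fromNat (suc m) * fromNat (toℕ s)
        b = B q (suc m)

  -- When `s` is the first letter, `inside-insertAt` is too weak, since a deletion lowers the number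
  -- of copies. Only constant words lie in the ball, so inserting anywhere amounts to inserting in
  -- front.
  inside-insertAt-zero : ∀ {r n} (x : Word (suc r) n) i y k → inside zero k (insertAt x i y) ≤ inside zero k (zero ∷ x)
  inside-insertAt-zero x zero zero    k = ≤-refl
  inside-insertAt-zero x zero (suc y) k = ≤-trans (≤-reflexive (inside-> zero k {suc y} ℕ.z<s x)) (0≤inside zero k (zero ∷ x))
  inside-insertAt-zero (zero  ∷ x) (suc i) y k =
    inside-∷-mono zero zero (insertAt x i y) (zero ∷ x) (inside-insertAt-zero x i y) k
  inside-insertAt-zero (suc z ∷ x) (suc i) y k =
    ≤-trans (≤-reflexive (inside-> zero k {suc z} ℕ.z<s (insertAt x i y))) (0≤inside zero k (zero ∷ suc z ∷ x))

  -- The shadow inequality over the rationals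

  ∑-+const : ∀ {A : Set} (xs : List A) g c → ∑ xs (λ x → g x + c) ≡ ∑ xs g + c * ∑ xs (λ _ → 1ℚ)
  ∑-+const xs g c = trans (∑-+ xs g (λ _ → c))
    (cong (∑ xs g +_) (trans (∑-cong xs (λ _ → sym (*-identityʳ c))) (∑-*ˡ xs c (λ _ → 1ℚ))))

  ∑-below : ∀ r k → ∑ (allFin r) (λ y → below k (toℕ y)) ≤ fromNat k
  ∑-below zero    k       = 0≤fromNat k
  ∑-below (suc r) zero    = ≤-reflexive (∑-0 (allFin (suc r)))
  ∑-below (suc r) (suc k) = ≤-trans (≤-reflexive (∑-allFin r (λ y → below (suc k) (toℕ y)))) (+-monoʳ-≤ 1ℚ (∑-below r k))

  1≤fromNat : ∀ q → 1ℚ ≤ fromNat (suc q)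
  1≤fromNat q = ≤-by (0≤fromNat q) refl

  -- The case n = 1 of the theorem, for a family of weight σ and maximum g over an alphabet with q = s − 1.

  FibreBounded : ℕ → ℚ → ℚ → Set
  FibreBounded zero      σ g = σ ≤ g
  FibreBounded q@(suc _) σ g = σ ⊓ fromNat q ≤ fromNat q * g

  -- What the argument uses of `f` and `Δf` at a fixed index, as exact inequalities; approximation
  -- errors go into the choice of `F` and `G`.
  record ShadowPair {r m} (s : Fin r) (F : Word r (suc m) → ℚ) (G : Word r m → ℚ) : Set where
    field
      nonneg  : ∀ w → 0ℚ ≤ F w
      inserts : ∀ x i y → F (insertAt x i y) ≤ G x
      fibres  : ∀ x → FibreBounded (toℕ s) (∑ (allFin r) (λ y → F (insertAt x (Fin.fromℕ m) y))) (G x)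

  open ShadowPair

  -- `H` majorizes the shadow of the ball. For `s` the first letter it is the ball restricted to
  -- words starting with `s`, and comparing total weights suffices. Otherwise it is the ball of the
  -- same index, and `∑-ballℚ-upper` meets `shadow-weight` at the concave bound.
  shadow-ballℚ : ∀ {r m} (s : Fin r) {F : Word r (suc m) → ℚ} {G} → ShadowPair s F G →
    ∀ k {a η} → 0ℚ ≤ a → a ≤ 1ℚ → 0ℚ ≤ η →
    ∑ (words r (suc m)) (ballℚ s k a) ≤ ∑ (words r (suc m)) F + η →
    ∃[ H ] (∀ x → 0ℚ ≤ H x) × (∀ x i y → ballℚ s k a (insertAt x i y) ≤ H x) ×
           ∑ (words r m) H ≤ ∑ (words r m) G + η
  shadow-ballℚ {suc r} {m} zero {F} {G} FG k {a} {η} 0≤a a≤1 0≤η ball≤ =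
    (λ x → ballℚ zero k a (zero ∷ x)) ,
    (λ x → 0≤ballℚ zero 0≤a a≤1 (zero ∷ x)) ,
    (λ x i y → ballℚ-mono zero 0≤a a≤1 (insertAt x i y) (zero ∷ x) (inside-insertAt-zero x i y)) ,
    (begin
      ∑ (words (suc r) m) (λ x → ballℚ zero k a (zero ∷ x))
        ≤⟨ ∑-∈ (λ y → ∑-nonneg (words (suc r) m) (λ x → 0≤ballℚ zero 0≤a a≤1 (y ∷ x))) (∈-allFin zero) ⟩
      ∑ (allFin (suc r)) (λ y → ∑ (words (suc r) m) (λ x → ballℚ zero k a (y ∷ x)))
        ≡⟨ ∑-words (suc r) m (ballℚ zero k a) ⟨
      ∑ (words (suc r) (suc m)) (ballℚ zero k a)
        ≤⟨ ball≤ ⟩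
      ∑ (words (suc r) (suc m)) F + η
        ≤⟨ +-monoˡ-≤ η (∑-words-fibres m F G (fibres FG)) ⟩
      ∑ (words (suc r) m) G + η ∎)
    where open ≤-Reasoning
  shadow-ballℚ {r} {m} s@(suc s′) {F} {G} FG k {a} {η} 0≤a a≤1 0≤η ball≤ =
    ballℚ s k a ,
    0≤ballℚ s 0≤a a≤1 ,
    (λ x i y → ballℚ-mono s 0≤a a≤1 (insertAt x i y) x (inside-insertAt s x i y)) ,
    *-cancelˡ-≤-pos (N * Q) (begin
      N * Q * ∑ (words r m) (ballℚ s k a)
        ≤⟨ ∑-ballℚ-upper s 0≤a a≤1 m ⟩
      ∑[1⋯ suc m ] (λ j → ∑ (words r (suc m)) (ballℚ s k a) ⊓ b j)
        -- Each minimum grows by at most `η`, and the total error `N * η` is at most `N * Q * η`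
        -- because `Q` is at least 1.
        ≤⟨ ∑[1⋯]-mono (suc m) (λ j _ → ≤-trans (⊓-monoˡ-≤ (b j) ball≤) (⊓-≤-+ ∣F∣ (b j) 0≤η)) ⟩
      ∑[1⋯ suc m ] (λ j → ∣F∣ ⊓ b j + η)
        ≡⟨ trans (∑[1⋯]-+ (suc m) (λ j → ∣F∣ ⊓ b j) (λ _ → η))
             (cong (∑[1⋯ suc m ] (λ j → ∣F∣ ⊓ b j) +_) (∑[1⋯]-const (suc m) η)) ⟩
      ∑[1⋯ suc m ] (λ j → ∣F∣ ⊓ b j) + N * η
        ≤⟨ +-mono-≤ (shadow-weight (toℕ s) m F G (nonneg FG) (inserts FG) (fibres FG))
             (*-monoˡ (0≤fromNat (suc m)) (≤-by (0≤-* (0≤-diff (1≤fromNat (toℕ s′))) 0≤η)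
               (solve 2 (λ Q η → η :+ (Q :- con 1ℚ) :* η := Q :* η) refl Q η))) ⟩
      N * Q * ∑ (words r m) G + N * (Q * η)
        ≡⟨ solve 4 (λ N Q g η → N :* Q :* g :+ N :* (Q :* η) := N :* Q :* (g :+ η)) refl N Q (∑ (words r m) G) η ⟩
      N * Q * (∑ (words r m) G + η) ∎)
    where
    open ≤-Reasoning
    N Q ∣F∣ : ℚ
    N = fromNat (suc m)
    Q = fromNat (toℕ s)
    ∣F∣ = ∑ (words r (suc m)) F
    b : ℕ → ℚ
    b = B (toℕ s) (suc m)
    instance
      Q-pos : Positive Q
      Q-pos = fromNat-pos (toℕ s′)
      NQ-pos : Positive (N * Q)
      NQ-pos = pos*pos⇒pos N {{fromNat-pos m}} Q

  -- Eventual properties of Cauchy sequences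

  module _ {P Q : ℕ → Set} where

    eventually-map : (∀ N → P N → Q N) → Eventually P → Eventually Q
    eventually-map P⇒Q (N₀ , p) = N₀ , λ N N₀≤N → P⇒Q N (p N N₀≤N)

    eventually-× : Eventually P → Eventually Q → Eventually (λ N → P N × Q N)
    eventually-× (M , p) (N , q) = M ℕ.⊔ N , λ n M⊔N≤n → p n (ℕ.m⊔n≤o⇒m≤o M N M⊔N≤n) , q n (ℕ.m⊔n≤o⇒n≤o M N M⊔N≤n)

  eventually-Fin : ∀ {r} {P : Fin r → ℕ → Set} → (∀ i → Eventually (P i)) → Eventually (λ N → ∀ i → P i N)
  eventually-Fin {zero}  p = 0 , λ _ _ ()
  eventually-Fin {suc r} p = eventually-map
    (λ { N (p₀ , ps) zero → p₀ ; N (p₀ , ps) (suc i) → ps i })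
    (eventually-× (p zero) (eventually-Fin (p ∘ suc)))

  eventually-Word : ∀ {r n} {P : Word r n → ℕ → Set} → (∀ w → Eventually (P w)) → Eventually (λ N → ∀ w → P w N)
  eventually-Word {n = zero}  p = eventually-map (λ { N p [] → p }) (p [])
  eventually-Word {n = suc n} p = eventually-map (λ { N p (y ∷ w) → p y w })
    (eventually-Fin (λ y → eventually-Word (λ w → p (y ∷ w))))

  some-or-all : ∀ {r} {P Q : Fin r → Set} → (∀ y → P y ⊎ Q y) → (∃[ y ] P y) ⊎ (∀ y → Q y)
  some-or-all {zero}  pq = inj₂ λ ()
  some-or-all {suc r} pq with pq zero | some-or-all (pq ∘ suc)
  ... | inj₁ p | _            = inj₁ (zero , p)
  ... | inj₂ q | inj₁ (y , p) = inj₁ (suc y , p)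
  ... | inj₂ q | inj₂ qs      = inj₂ λ { zero → q ; (suc y) → qs y }

  -- The order of the reals is not decidable, but these alternatives overlap: from `M` on, the
  -- sequence stays within `½ * δ` of its value at `M`, and that rational is compared with `½ * δ`.
  positive-or-small : ∀ (x : ℝ) {δ} → 0ℚ < δ → 0ℝ D.< x ⊎ Eventually (λ N → seq x N ≤ δ)
  positive-or-small x {δ} 0<δ with cauchy x (½ * δ) (*-monoʳ-<-pos ½ 0<δ)
  ... | M , close with seq x M ≤? ½ * δ
  ...   | yes xM≤ = inj₂ (M , λ N M≤N → begin
          seq x N              ≤⟨ dist⇒≤ (seq x N) (seq x M) (close N M M≤N ℕ.≤-refl) ⟩
          seq x M + ½ * δ      ≤⟨ +-monoˡ-≤ (½ * δ) xM≤ ⟩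
          ½ * δ + ½ * δ        ≡⟨ solve 1 (λ δ → con ½ :* δ :+ con ½ :* δ := δ) refl δ ⟩
          δ                    ∎)
          where open ≤-Reasoning
  ...   | no xM≰ = inj₁ (D.*<* (seq x M - ½ * δ)
          (≤-<-trans (≤-reflexive (sym (+-inverseʳ (½ * δ)))) (+-monoˡ-< (- (½ * δ)) (≰⇒> xM≰)))
          (M , λ N M≤N → begin
            0ℚ + (seq x M - ½ * δ)
              ≤⟨ +-monoʳ-≤ 0ℚ (+-monoˡ-≤ (- (½ * δ)) (dist⇒≤ (seq x M) (seq x N) (close M N ℕ.≤-refl M≤N))) ⟩
            0ℚ + (seq x N + ½ * δ - ½ * δ)
              ≡⟨ solve 2 (λ x e → con 0ℚ :+ (x :+ e :- e) := x) refl (seq x N) (½ * δ) ⟩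
            seq x N                          ∎))
          where open ≤-Reasoning

  -- Families evaluated at a fixed index

  module _ (N : ℕ) where

    at : ∀ {r n} → Family r n → Word r n → ℚ
    at f w = seq (value (f w)) N

    seq-weight : ∀ {r n} (f : Family r n) → (seq ∣ f ∣ N) ≡ ∑ (words r n) (at f)
    seq-weight {r} {n} f = go (words r n)
      where
      go : ∀ ws → seq (foldr D._+_ 0ℝ (map (λ w → value (f w)) ws)) N ≡ ∑ ws (at f)
      go []       = refl
      go (w ∷ ws) = cong (at f w +_) (go ws)

    0≤maximum : ∀ us → 0ℚ ≤ seq (value (maximum us)) N
    0≤maximum []       = ≤-refl
    0≤maximum (u ∷ us) = ≤-trans (0≤maximum us) (p≤q⊔p (seq (value u) N) _)

    ∈⇒≤maximum : ∀ {us u} → u ∈ us → seq (value u) N ≤ seq (value (maximum us)) N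
    ∈⇒≤maximum (here refl)             = p≤p⊔q _ _
    ∈⇒≤maximum (there {u} u∈us) = ≤-trans (∈⇒≤maximum u∈us) (p≤q⊔p (seq (value u) N) _)

    -- At a fixed index the members may all be negative, so the 0 from which `maximum` starts needs
    -- its own bound.
    maximum-lub : ∀ us {c} → 0ℚ ≤ c → (∀ {u} → u ∈ us → seq (value u) N ≤ c) → seq (value (maximum us)) N ≤ c
    maximum-lub []       0≤c us≤c = 0≤c
    maximum-lub (u ∷ us) 0≤c us≤c = ⊔-lub (us≤c (here refl)) (maximum-lub us 0≤c (us≤c ∘ there))

    module _ {r n} (f : Family r (suc n)) (x : Word r n) where

      0≤Δ : 0ℚ ≤ at (Δ f) x
      0≤Δ = 0≤maximum (cartesianProductWith (λ y i → f (insertAt x i y)) (allFin r) (allFin (suc n)))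

      insertAt≤Δ : ∀ i y → at f (insertAt x i y) ≤ at (Δ f) x
      insertAt≤Δ i y = ∈⇒≤maximum (∈-cartesianProductWith⁺ (λ y i → f (insertAt x i y)) (∈-allFin y) (∈-allFin i))

      Δ-lub : ∀ {c} → 0ℚ ≤ c → (∀ i y → at f (insertAt x i y) ≤ c) → at (Δ f) x ≤ c
      Δ-lub 0≤c f≤c = maximum-lub _ 0≤c λ u∈ →
        bound (∈-cartesianProductWith⁻ (λ y i → f (insertAt x i y)) (allFin r) (allFin (suc n)) u∈)
        where
        bound : ∀ {u} → ∃[ y ] ∃[ i ] y ∈ allFin r × i ∈ allFin (suc n) × u ≡ f (insertAt x i y) → seq (value u) N ≤ _
        bound (y , i , _ , _ , refl) = f≤c i y

    at-ball : ∀ {r n} (s : Fin r) k α (w : Word r n) → at (ball n s k α) w ≡ ballℚ s k (seq (value α) N) w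
    at-ball s k α w with does (all? (Fin._≤? s) w)
    ... | false = solve 1 (λ a → con 0ℚ := (con 1ℚ :- a) :* con 0ℚ :+ a :* con 0ℚ) refl (seq (value α) N)
    ... | true with count (Fin._≟ s) w
    ...   | j with j ℕ.≤? k
    ...     | yes j≤k rewrite dec-true (j ℕ.≤? k) j≤k | below-< (ℕ.s≤s j≤k) | below-< (ℕ.m≤n⇒m≤1+n (ℕ.s≤s j≤k)) =
      solve 1 (λ a → con 1ℚ := (con 1ℚ :- a) :* con 1ℚ :+ a :* con 1ℚ) refl (seq (value α) N)
    ...     | no j≰k with j ℕ.≟ suc k
    ...       | yes refl rewrite dec-false (suc k ℕ.≤? k) j≰k | dec-true (suc k ℕ.≟ suc k) refl
                            | below-≥ {suc k} {suc k} ℕ.≤-refl | below-< {suc k} {suc (suc k)} ℕ.≤-refl =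
      solve 1 (λ a → a := (con 1ℚ :- a) :* con 0ℚ :+ a :* con 1ℚ) refl (seq (value α) N)
    ...       | no j≢ rewrite dec-false (j ℕ.≤? k) j≰k | dec-false (j ℕ.≟ suc k) j≢
                            | below-≥ (ℕ.≰⇒> j≰k) | below-≥ (ℕ.≤∧≢⇒< (ℕ.≰⇒> j≰k) (j≢ ∘ sym)) =
      solve 1 (λ a → con 0ℚ := (con 1ℚ :- a) :* con 0ℚ :+ a :* con 0ℚ) refl (seq (value α) N)

  -- Lines in the last coordinate under approximate compression

  insertAt-[]≔ : ∀ {A : Set} {n} (x : Vec A n) i y z → insertAt x i y [ i ]≔ z ≡ insertAt x i z
  insertAt-[]≔ x       zero    y z = refl
  insertAt-[]≔ (w ∷ x) (suc i) y z = cong (w ∷_) (insertAt-[]≔ x i y z)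

  -- If `g` is at least 1, the cap `fromNat q` settles `q ≥ 1`. For `q = 0` there is no cap and the
  -- weight itself must be bounded.
  fibre-large : ∀ q {σ g} → 1ℚ ≤ g → (q ≡ 0 → σ ≤ g) → FibreBounded q σ g
  fibre-large zero    1≤g σ≤g = σ≤g refl
  fibre-large (suc q) {σ} {g} 1≤g σ≤g = begin
    σ ⊓ fromNat (suc q)      ≤⟨ p⊓q≤q σ (fromNat (suc q)) ⟩
    fromNat (suc q)          ≡⟨ *-identityʳ (fromNat (suc q)) ⟨
    fromNat (suc q) * 1ℚ     ≤⟨ *-monoˡ (0≤fromNat (suc q)) 1≤g ⟩
    fromNat (suc q) * g      ∎
    where open ≤-Reasoning

  -- For a line on which only the first `q ⊔ 1` letters carry more than an error, each of them at
  -- most `g`.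
  fibre-small : ∀ q {σ g c} → 0ℚ ≤ c → σ ≤ fromNat (q ℕ.⊔ 1) * g + c → FibreBounded q σ (g + c)
  fibre-small zero    {σ} {g} {c} 0≤c σ≤ = ≤-trans σ≤ (≤-reflexive
    (solve 2 (λ g c → (con 1ℚ :+ con 0ℚ) :* g :+ c := g :+ c) refl g c))
  fibre-small (suc q) {σ} {g} {c} 0≤c σ≤ rewrite ℕ.⊔-identityʳ q = begin
    σ ⊓ fromNat (suc q)           ≤⟨ p⊓q≤p σ (fromNat (suc q)) ⟩
    σ                             ≤⟨ σ≤ ⟩
    fromNat (suc q) * g + c       ≤⟨ ≤-by (0≤-* (0≤-diff (1≤fromNat q)) 0≤c)
                                       (solve 3 (λ q g c → q :* g :+ c :+ (q :- con 1ℚ) :* c := q :* (g :+ c)) refl (fromNat (suc q)) g c) ⟩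
    fromNat (suc q) * (g + c)     ∎
    where open ≤-Reasoning

  #letters : ℕ → ℚ
  #letters r = ∑ (allFin r) (λ _ → 1ℚ)

  #words : ℕ → ℕ → ℚ
  #words r n = ∑ (words r n) (λ _ → 1ℚ)

  -- Approximation errors at a fixed index, in multiples of δ: κ for a value of Δf, slope for ∣Δf∣.
  κ slope : ℕ → ℕ → ℚ
  κ r m = #letters (suc r) + (1ℚ + 1ℚ + #words (suc r) (suc m))
  slope r m = κ r m * #words (suc r) m + (1ℚ + #words (suc r) (suc m) + #words (suc r) m)

  0≤#letters : ∀ r → 0ℚ ≤ #letters r
  0≤#letters r = ∑-nonneg (allFin r) (λ _ → 0≤1ℚ)

  0≤#words : ∀ r n → 0ℚ ≤ #words r n
  0≤#words r n = ∑-nonneg (words r n) (λ _ → 0≤1ℚ)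

  0≤κ : ∀ r m → 0ℚ ≤ κ r m
  0≤κ r m = 0≤-+ (0≤#letters (suc r)) (0≤-+ (0≤-+ 0≤1ℚ 0≤1ℚ) (0≤#words (suc r) (suc m)))

  0≤slope : ∀ r m → 0ℚ ≤ slope r m
  0≤slope r m = 0≤-+ (0≤-* (0≤κ r m) (0≤#words (suc r) m))
    (0≤-+ (0≤-+ 0≤1ℚ (0≤#words (suc r) (suc m))) (0≤#words (suc r) m))

  module _ {r m : ℕ} (s : Fin (suc r)) (f : Family (suc r) (suc m)) (f-compressed : Compressed s f)
           (∣f∣≤ : ∣ f ∣ D.≤ fromℕ (suc (toℕ s) ^ suc m)) {δ : ℚ} (0<δ : 0ℚ < δ)
    where
    private
      0≤δ : 0ℚ ≤ δ
      0≤δ = <⇒≤ 0<δ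

      -- At a finite index a value of `f` may be slightly negative; cutting off at 0 restores the
      -- sign that the rational argument requires.
      F : ℕ → Word (suc r) (suc m) → ℚ
      F N w = 0ℚ ⊔ at N f w

      G : ℕ → Word (suc r) m → ℚ
      G N x = at N (Δ f) x + κ r m * δ

      0≤F : ∀ N w → 0ℚ ≤ F N w
      0≤F N w = p≤p⊔q 0ℚ (at N f w)

      F≤Δ : ∀ N x i y → F N (insertAt x i y) ≤ at N (Δ f) x
      F≤Δ N x i y = ⊔-lub (0≤Δ N f x) (insertAt≤Δ N f x i y)

      ext : Word (suc r) m → Fin (suc r) → Word (suc r) (suc m)
      ext x = insertAt x (Fin.fromℕ m)

      fibre : ℕ → Word (suc r) m → ℚ
      fibre N x = ∑ (allFin (suc r)) (λ y → F N (ext x y))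

    eventually-0≤ : Eventually (λ N → ∀ w → 0ℚ ≤ at N f w + δ)
    eventually-0≤ = eventually-Word (λ w → slack (D.0≤ (f w)) δ 0<δ)

    -- When `s` is the first letter, the bound on the weight is a power of 1, and `fibre-with-one`
    -- relies on it.
    eventually-light : Eventually (λ N → toℕ s ≡ 0 → ∑ (words (suc r) (suc m)) (at N f) ≤ 1ℚ + δ)
    eventually-light = go (toℕ s) ∣f∣≤
      where
      go : ∀ q → ∣ f ∣ D.≤ fromℕ (suc q ^ suc m) → Eventually (λ N → q ≡ 0 → ∑ (words (suc r) (suc m)) (at N f) ≤ 1ℚ + δ)
      go (suc _) _ = 0 , λ _ _ ()
      go zero    ∣f∣≤1 rewrite ℕ.^-zeroˡ (suc m) = eventually-map
        (λ N ≤1+δ _ → ≤-trans (≤-reflexive (sym (seq-weight N f))) ≤1+δ) (slack ∣f∣≤1 δ 0<δ)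

    -- The single use of compression: the last letter is lowered to the smallest one.
    compressed-zero : ∀ x {y} → 0 ℕ.< toℕ y → s Fin.≤ y → 0ℝ D.< value (f (ext x y)) → 1ℝ D.≤ value (f (ext x zero))
    compressed-zero x {y} 0<y s≤y 0<f = proj₂ (subst (λ w → value (f w) D.≃ 1ℝ) (insertAt-[]≔ x (Fin.fromℕ m) y zero)
      (f-compressed (ext x y) zero (Fin.fromℕ m)
        (subst (λ z → 0 ℕ.< toℕ z) (sym lookup-y) 0<y) (subst (s Fin.≤_) (sym lookup-y) s≤y) 0<f))
      where
      lookup-y : lookup (ext x y) (Fin.fromℕ m) ≡ y
      lookup-y = insertAt-lookup x (Fin.fromℕ m) y

    fibre-with-one : ∀ N x → (∀ w → 0ℚ ≤ at N f w + δ) →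
      (toℕ s ≡ 0 → ∑ (words (suc r) (suc m)) (at N f) ≤ 1ℚ + δ) →
      1ℚ ≤ at N f (ext x zero) + δ → FibreBounded (toℕ s) (fibre N x) (G N x)
    fibre-with-one N x 0≤f+δ light 1≤f+δ = fibre-large (toℕ s)
      (≤-trans 1≤Δ+δ (≤-by (0≤-* (0≤-+ (0≤#letters (suc r)) (0≤-+ 0≤1ℚ (0≤#words (suc r) (suc m)))) 0≤δ)
        (solve 4 (λ g a b δ → g :+ δ :+ (a :+ (con 1ℚ :+ b)) :* δ := g :+ (a :+ (con 1ℚ :+ con 1ℚ :+ b)) :* δ) refl
          (at N (Δ f) x) (#letters (suc r)) (#words (suc r) (suc m)) δ)))
      λ s≡0 → begin
        fibre N x
          ≤⟨ ∑-fibre-≤ m (F N) (0≤F N) x ⟩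
        ∑ (words (suc r) (suc m)) (F N)
          -- No value is below `- δ`, so the cut-off at 0 costs at most `δ` per word.
          ≤⟨ ∑-mono (words (suc r) (suc m)) (λ w → ⊔-lub (0≤f+δ w) (p≤p+q (at N f w) 0≤δ)) ⟩
        ∑ (words (suc r) (suc m)) (λ w → at N f w + δ)
          ≡⟨ ∑-+const (words (suc r) (suc m)) (at N f) δ ⟩
        ∑ (words (suc r) (suc m)) (at N f) + δ * #words (suc r) (suc m)
          ≤⟨ +-monoˡ-≤ (δ * #words (suc r) (suc m)) (≤-trans (light s≡0) (+-monoˡ-≤ δ 1≤Δ+δ)) ⟩
        at N (Δ f) x + δ + δ + δ * #words (suc r) (suc m)
          ≤⟨ ≤-by (0≤-* (0≤#letters (suc r)) 0≤δ)
               (solve 4 (λ g a b δ → g :+ δ :+ δ :+ δ :* b :+ a :* δ := g :+ (a :+ (con 1ℚ :+ con 1ℚ :+ b)) :* δ) refl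
                 (at N (Δ f) x) (#letters (suc r)) (#words (suc r) (suc m)) δ) ⟩
        G N x ∎
      where
      open ≤-Reasoning
      1≤Δ+δ : 1ℚ ≤ at N (Δ f) x + δ
      1≤Δ+δ = ≤-trans 1≤f+δ (+-monoˡ-≤ δ (insertAt≤Δ N f x (Fin.fromℕ m) zero))

    fibre-without-one : ∀ N x → (∀ y → 0 ℕ.< toℕ y → s Fin.≤ y → at N f (ext x y) ≤ δ) →
      FibreBounded (toℕ s) (fibre N x) (G N x)
    fibre-without-one N x small = fibre-small (toℕ s)
      (0≤-* (0≤κ r m) 0≤δ)
      (begin
        fibre N x
          ≤⟨ ∑-mono (allFin (suc r)) pointwise ⟩
        ∑ (allFin (suc r)) (λ y → M * below t (toℕ y) + δ)
          ≡⟨ trans (∑-+const (allFin (suc r)) (λ y → M * below t (toℕ y)) δ)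
               (cong (_+ δ * #letters (suc r)) (∑-*ˡ (allFin (suc r)) M (λ y → below t (toℕ y)))) ⟩
        M * ∑ (allFin (suc r)) (λ y → below t (toℕ y)) + δ * #letters (suc r)
          ≤⟨ +-monoˡ-≤ (δ * #letters (suc r)) (*-monoˡ (0≤Δ N f x) (∑-below (suc r) t)) ⟩
        M * fromNat t + δ * #letters (suc r)
          ≤⟨ ≤-by (0≤-* (0≤-+ (0≤-+ 0≤1ℚ 0≤1ℚ) (0≤#words (suc r) (suc m))) 0≤δ)
               (solve 5 (λ M t δ a b → M :* t :+ δ :* a :+ (con 1ℚ :+ con 1ℚ :+ b) :* δ := t :* M :+ (a :+ (con 1ℚ :+ con 1ℚ :+ b)) :* δ) refl
                 M (fromNat t) δ (#letters (suc r)) (#words (suc r) (suc m))) ⟩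
        fromNat t * M + κ r m * δ ∎)
      where
      open ≤-Reasoning
      t : ℕ
      -- Compression restricts letters that are at least `s` and have a smaller letter, so the first
      -- letter is exempt even when it is `s`.
      t = toℕ s ℕ.⊔ 1
      M : ℚ
      M = at N (Δ f) x
      pointwise : ∀ y → F N (ext x y) ≤ M * below t (toℕ y) + δ
      pointwise y with toℕ y ℕ.<? t
      ... | yes y<t rewrite below-< y<t = ≤-trans (F≤Δ N x (Fin.fromℕ m) y)
        (≤-by 0≤δ (cong (_+ δ) (sym (*-identityʳ M))))
      ... | no  y≮t rewrite below-≥ (ℕ.≮⇒≥ y≮t) = ≤-trans
        (⊔-lub 0≤δ (small y (ℕ.m⊔n≤o⇒n≤o (toℕ s) 1 (ℕ.≮⇒≥ y≮t)) (ℕ.m⊔n≤o⇒m≤o (toℕ s) 1 (ℕ.≮⇒≥ y≮t))))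
        (≤-reflexive (solve 2 (λ M δ → δ := M :* con 0ℚ :+ δ) refl M δ))

    -- Each line is classified on the reals, before an index is chosen: some restricted letter has
    -- positive value, and then the smallest letter has value 1, or all of them are eventually at
    -- most `δ`. As there are finitely many lines, one index serves all.
    eventually-fibres : Eventually (λ N → ∀ x → FibreBounded (toℕ s) (fibre N x) (G N x))
    eventually-fibres = eventually-Word λ x → fibre-bounded x (some-or-all (one-or-small x))
      where
      LargePositive SmallEventually : Word (suc r) m → Fin (suc r) → Set
      LargePositive x y = 0 ℕ.< toℕ y × s Fin.≤ y × 0ℝ D.< value (f (ext x y))
      SmallEventually x y = Eventually (λ N → 0 ℕ.< toℕ y → s Fin.≤ y → at N f (ext x y) ≤ δ)

      one-or-small : ∀ x y → LargePositive x y ⊎ SmallEventually x y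
      one-or-small x y with 0 ℕ.<? toℕ y | s Fin.≤? y | positive-or-small (value (f (ext x y))) 0<δ
      ... | no 0≮y  | _       | _        = inj₂ (0 , λ _ _ 0<y _ → contradiction 0<y 0≮y)
      ... | yes _   | no s≰y  | _        = inj₂ (0 , λ _ _ _ s≤y → contradiction s≤y s≰y)
      ... | yes 0<y | yes s≤y | inj₁ 0<f = inj₁ (0<y , s≤y , 0<f)
      ... | yes _   | yes _   | inj₂ f≤δ = inj₂ (eventually-map (λ _ f≤δ _ _ → f≤δ) f≤δ)

      fibre-bounded : ∀ x → (∃[ y ] LargePositive x y) ⊎ (∀ y → SmallEventually x y) →
        Eventually (λ N → FibreBounded (toℕ s) (fibre N x) (G N x))
      fibre-bounded x (inj₁ (y , 0<y , s≤y , 0<f)) = eventually-map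
        (λ { N (0≤f+δ , light , 1≤f+δ) → fibre-with-one N x 0≤f+δ light 1≤f+δ })
        (eventually-× eventually-0≤ (eventually-× eventually-light (slack (compressed-zero x 0<y s≤y 0<f) δ 0<δ)))
      fibre-bounded x (inj₂ small) = eventually-map (λ N → fibre-without-one N x) (eventually-Fin small)

    -- Transfer to the ball and passage to the limit

    module _ (k : ℕ) (α : [0,1]) (∣h∣≤∣f∣ : ∣ ball (suc m) s k α ∣ D.≤ ∣ f ∣) where
      private
        h : Family (suc r) (suc m)
        h = ball (suc m) s k α

      shadow-at : ∀ N → (∀ x → FibreBounded (toℕ s) (fibre N x) (G N x)) →
        0ℚ ≤ seq (value α) N + δ → seq (value α) N ≤ 1ℚ + δ →
        (seq ∣ h ∣ N) ≤ ((seq ∣ f ∣ N) + δ) →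
        (seq ∣ Δ h ∣ N) ≤ ((seq ∣ Δ f ∣ N) + slope r m * δ)
      shadow-at N fibres 0≤α+δ α≤1+δ ∣h∣≤∣f∣+δ = conclude
        (shadow-ballℚ s (record
        { nonneg  = 0≤F N
        ; inserts = λ x i y → ≤-trans (F≤Δ N x i y) (p≤p+q (at N (Δ f) x) 0≤κδ)
        ; fibres  = fibres })
          k {clamped} {η} (p≤p⊔q 0ℚ (a ⊓ 1ℚ)) (⊔-lub 0≤1ℚ (p⊓q≤q a 1ℚ)) 0≤η ball≤)
        where
        open ≤-Reasoning
        a clamped η : ℚ
        a = seq (value α) N
        -- The approximation of `α` may leave the unit interval by up to `δ`, so clamping moves it
        -- by at most `δ`.
        clamped = 0ℚ ⊔ (a ⊓ 1ℚ)
        -- One `δ` from comparing the weights of `h` and `f`, and one per word from clamping.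
        η = δ + δ * #words (suc r) (suc m)

        0≤κδ : 0ℚ ≤ κ r m * δ
        0≤κδ = 0≤-* (0≤κ r m) 0≤δ

        0≤η : 0ℚ ≤ η
        0≤η = 0≤-+ 0≤δ (0≤-* 0≤δ (0≤#words (suc r) (suc m)))

        clamped≤a+δ : clamped ≤ a + δ
        clamped≤a+δ = ⊔-lub 0≤α+δ (≤-trans (p⊓q≤p a 1ℚ) (p≤p+q a 0≤δ))

        a≤clamped+δ : a ≤ clamped + δ
        a≤clamped+δ = ≤-trans (≤-trans (⊓-glb (p≤p+q a 0≤δ) α≤1+δ)
          (≤-reflexive (sym (mono-≤-distrib-⊓ (+-monoˡ-≤ δ) a 1ℚ)))) (+-monoˡ-≤ δ (p≤q⊔p 0ℚ (a ⊓ 1ℚ)))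

        ball≤ : ∑ (words (suc r) (suc m)) (ballℚ s k clamped) ≤ ∑ (words (suc r) (suc m)) (F N) + η
        ball≤ = begin
          ∑ (words (suc r) (suc m)) (ballℚ s k clamped)
            ≤⟨ ∑-mono (words (suc r) (suc m)) (λ w → ≤-trans (ballℚ-insensitive s k {a′ = a} 0≤δ clamped≤a+δ w)
                 (≤-reflexive (cong (_+ δ) (sym (at-ball N s k α w))))) ⟩
          ∑ (words (suc r) (suc m)) (λ w → at N h w + δ)
            ≡⟨ trans (∑-+const (words (suc r) (suc m)) (at N h) δ)
                 (cong (_+ δ * #words (suc r) (suc m)) (sym (seq-weight N h))) ⟩
          (seq ∣ h ∣ N) + δ * #words (suc r) (suc m)
            ≤⟨ +-monoˡ-≤ (δ * #words (suc r) (suc m)) ∣h∣≤∣f∣+δ ⟩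
          (seq ∣ f ∣ N) + δ + δ * #words (suc r) (suc m)
            ≡⟨ +-assoc (seq ∣ f ∣ N) δ (δ * #words (suc r) (suc m)) ⟩
          (seq ∣ f ∣ N) + η
            ≤⟨ +-monoˡ-≤ η (≤-trans (≤-reflexive (seq-weight N f)) (∑-mono (words (suc r) (suc m)) (λ w → p≤q⊔p 0ℚ (at N f w)))) ⟩
          ∑ (words (suc r) (suc m)) (F N) + η ∎

        conclude : ∃[ H ] (∀ x → 0ℚ ≤ H x) × (∀ x i y → ballℚ s k clamped (insertAt x i y) ≤ H x) ×
                          ∑ (words (suc r) m) H ≤ ∑ (words (suc r) m) (G N) + η →
          (seq ∣ Δ h ∣ N) ≤ ((seq ∣ Δ f ∣ N) + slope r m * δ)
        conclude (H , 0≤H , ball≤H , ∑H≤) = begin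
          (seq ∣ Δ h ∣ N)
            ≡⟨ seq-weight N (Δ h) ⟩
          ∑ (words (suc r) m) (at N (Δ h))
            -- Undoing the clamping costs a further `δ` for each word of the shadow.
            ≤⟨ ∑-mono (words (suc r) m) (λ x → Δ-lub N h x (0≤-+ (0≤H x) 0≤δ) (λ i y →
                 ≤-trans (≤-reflexive (at-ball N s k α (insertAt x i y)))
                   (≤-trans (ballℚ-insensitive s k {a′ = clamped} 0≤δ a≤clamped+δ (insertAt x i y)) (+-monoˡ-≤ δ (ball≤H x i y))))) ⟩
          ∑ (words (suc r) m) (λ x → H x + δ)
            ≡⟨ ∑-+const (words (suc r) m) H δ ⟩
          ∑ (words (suc r) m) H + δ * #words (suc r) m
            ≤⟨ +-monoˡ-≤ (δ * #words (suc r) m) ∑H≤ ⟩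
          ∑ (words (suc r) m) (G N) + η + δ * #words (suc r) m
            ≡⟨ cong (λ z → z + η + δ * #words (suc r) m) (trans (∑-+const (words (suc r) m) (at N (Δ f)) (κ r m * δ))
                 (cong (_+ κ r m * δ * #words (suc r) m) (sym (seq-weight N (Δ f))))) ⟩
          (seq ∣ Δ f ∣ N) + κ r m * δ * #words (suc r) m + η + δ * #words (suc r) m
            ≡⟨ solve 5 (λ g κ δ n m → g :+ κ :* δ :* m :+ (δ :+ δ :* n) :+ δ :* m := g :+ (κ :* m :+ (con 1ℚ :+ n :+ m)) :* δ) refl
                 (seq ∣ Δ f ∣ N) (κ r m) δ (#words (suc r) (suc m)) (#words (suc r) m) ⟩
          ((seq ∣ Δ f ∣ N) + slope r m * δ) ∎

      eventually-shadow : Eventually (λ N → (seq ∣ Δ h ∣ N) ≤ ((seq ∣ Δ f ∣ N) + slope r m * δ))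
      eventually-shadow = eventually-map
        (λ { N (fibres , 0≤α+δ , α≤1+δ , ∣h∣≤) → shadow-at N fibres 0≤α+δ α≤1+δ ∣h∣≤ })
        (eventually-× eventually-fibres (eventually-× (slack (D.0≤ α) δ 0<δ)
          (eventually-× (slack (D.≤1 α) δ 0<δ) (slack ∣h∣≤∣f∣ δ 0<δ))))

  -- The estimate is applied with `ε` divided by `1ℚ + c`; the summand 1 keeps the divisor positive
  -- when `c` is 0.
  ≤-by-scaled-slack : ∀ {x y} c → 0ℚ ≤ c →
    (∀ {δ} → 0ℚ < δ → Eventually (λ N → seq x N ≤ seq y N + c * δ)) → x D.≤ y
  ≤-by-scaled-slack {x} {y} c 0≤c x≤y = D.*≤* λ ε 0<ε → eventually-map
    (λ N x≤ → ≤-trans x≤ (+-monoʳ-≤ (seq y N) (begin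
      c * (1/ (1ℚ + c) * ε)
        ≤⟨ ≤-by (<⇒≤ (0<δ 0<ε)) (solve 2 (λ c δ → c :* δ :+ δ := (con 1ℚ :+ c) :* δ) refl c (1/ (1ℚ + c) * ε)) ⟩
      (1ℚ + c) * (1/ (1ℚ + c) * ε)    ≡⟨ *-assoc (1ℚ + c) (1/ (1ℚ + c)) ε ⟨
      (1ℚ + c) * 1/ (1ℚ + c) * ε      ≡⟨ cong (_* ε) (*-inverseʳ (1ℚ + c)) ⟩
      1ℚ * ε                          ≡⟨ *-identityˡ ε ⟩
      ε                               ∎)))
    (x≤y (0<δ 0<ε))
    where
    open ≤-Reasoning
    instance
      1+c-pos : Positive (1ℚ + c)
      1+c-pos = pos+nonNeg⇒pos 1ℚ c {{nonNegative 0≤c}}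
      1+c-nonZero : NonZero (1ℚ + c)
      1+c-nonZero = pos⇒nonZero (1ℚ + c)
    0<δ : ∀ {ε} → 0ℚ < ε → 0ℚ < 1/ (1ℚ + c) * ε
    0<δ {ε} 0<ε = positive⁻¹ (1/ (1ℚ + c) * ε) {{pos*pos⇒pos (1/ (1ℚ + c)) {{1/pos⇒pos (1ℚ + c)}} ε {{positive 0<ε}}}}

open import Defs
open import Data.Fin using (Fin; toℕ)
open import Data.Nat using (ℕ; suc; _^_)
open import Data.Product using (_,_)

theorem4 : ∀ (r m : ℕ) → let n = suc m in
    (s : Fin r) (f : Family r n) →
    Compressed s f →
    ∣ f ∣ ≤ fromℕ (suc (toℕ s) ^ n) →
    (k : ℕ) (α : [0,1]) → let h = ball n s k α in
    ∣ h ∣ ≃ ∣ f ∣ →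
    ∣ Δ h ∣ ≤ ∣ Δ f ∣
theorem4 (suc r) m s f f-compressed ∣f∣≤ k α (∣h∣≤∣f∣ , _) =
  ≤-by-scaled-slack (slope r m) (0≤slope r m)
    λ 0<δ → eventually-shadow s f f-compressed ∣f∣≤ 0<δ k α ∣h∣≤∣f∣
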